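{- For all $n\ge1$, $k\ge0$ and $\vec\beta\in\mathbb N^{l-1}$, $$Q_{n,k,\vec{\beta}}=\sum_{\substack{\pi\in C_l\wr\mathfrak{S}_n\\ \mathrm{inv}_{<2}(\pi)=k,\ \vec{\mathrm{col}}(\pi)=\vec{\beta}}}F_{n,\mathrm{DES}_{\geq2}(\pi)}.$$
   Context: Fix $l\ge1$. $C_l\wr\mathfrak{S}_n$ is the set of words $\pi=\pi_1\cdots\pi_n$ with letters $\pi_i=|\pi_i|^{\epsilon_i}$, $\epsilon_i\in\{0,\dots,l-1\}$, such that $|\pi_1|\cdots|\pi_n|$ is a permutation of $[n]$; $\vec{\mathrm{col}}(\pi)=(\mathrm{col}_1(\pi),\dots,\mathrm{col}_{l-1}(\pi))$ with $\mathrm{col}_m(\pi)=|\{i:\epsilon_i=m\}|$. For $k\ge1$: $\mathrm{DES}_{\ge k}(\pi)=\{i\in[n-1]:|\pi_i|>|\pi_{i+1}|\text{ and either }\epsilon_i\neq0\text{ or }|\pi_i|-|\pi_{i+1}|\ge k\}$ and $\mathrm{inv}_{<k}(\pi)=|\{(i,j):i<j,\ \epsilon_i=0,\ 0<|\pi_i|-|\pi_j|<k\}|$. For $S\subseteq[n-1]$, $F_{n,S}=\sum x_{i_1}\cdots x_{i_n}$ over $i_1\ge\dots\ge i_n\ge1$ with $i_j>i_{j+1}$ whenever $j\in S$. Let $\mathcal{B}$ be the ordered alphabet $1^0<1^1<\cdots<1^{l-1}<\overline{1^0}<2^0<\cdots<2^{l-1}<\overline{2^0}<3^0<\cdots$;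 $u^m$ is $m$-colored (unbarred), $\overline{u^0}$ is $0$-colored and barred; both have absolute value $u$ and weight $x_u$. A colored necklace is a primitive circular word over $\mathcal{B}$ (not a rotation class of a proper power) such that every barred letter is followed clockwise by a letter of lesser or equal absolute value, every $0$-colored unbarred letter is followed by a letter of greater or equal absolute value, and a length-one necklace is not a barred letter. A colored ornament is a finite multiset of colored necklaces; its weight is the product of the weights of its letters and its color vector counts its $m$-colored letters, $m=1,\dots,l-1$. The colored Eulerian quasisymmetric function $Q_{n,k,\vec\beta}$ is (via Hyatt's colored-ornament interpretation, taken as definition) the sum of the weights of all colored ornaments of total length $n$ with exactly $k$ barred letters and color vector $\vec\beta$. -}

module Defs where

open import Data.Nat using (ℕ; zero; suc; _+_; _∸_; _≡ᵇ_; _<ᵇ_; _≤ᵇ_)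
open import Data.Bool using (Bool; true; false; _∧_; _∨_; not; if_then_else_; T)
open import Data.List using (List; []; _∷_; length; map; concat; zip; drop; take; _++_; applyUpTo)
open import Data.Bool.ListAction using (all; any)
open import Data.Fin using (Fin; toℕ)
open import Data.Vec using (Vec; tabulate)
open import Data.Product using (Σ; _×_; _,_; ∃; proj₁)
open import Function.Bundles using (_↔_)
open import Relation.Binary.PropositionalEquality using (_≡_)

cntBy : {A : Set} → (A → Bool) → List A → ℕ
cntBy p [] = 0
cntBy p (x ∷ xs) = if p x then suc (cntBy p xs) else cntBy p xs

sameMultiset : List ℕ → List ℕ → Bool
sameMultiset xs ys =
  all (λ v → cntBy (v ≡ᵇ_) xs ≡ᵇ cntBy (v ≡ᵇ_) ys) (xs ++ ys)

-- Formal power series with ℕ coefficients in x₁, x₂, … given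
-- combinatorially as  Σ_{a ∈ A} x^{wt a}, where  wt a = [i₁,…,iₙ]
-- encodes the monomial x_{i₁}⋯x_{iₙ} (two lists give the same monomial
-- iff they are equal as multisets).

Fiber : (A : Set) → (A → List ℕ) → List ℕ → Set
Fiber A wt c = Σ A (λ a → T (sameMultiset (wt a) c))

SameGF : (A : Set) → (A → List ℕ) → (B : Set) → (B → List ℕ) → Set
SameGF A wa B wb =
  (c : List ℕ) → ∃ λ N → (Fiber A wa c ↔ Fin N) × (Fiber B wb c ↔ Fin N)

-- Fundamental quasisymmetric function F_{n,S}:
-- sequences i₁ ≥ … ≥ iₙ ≥ 1 with i_j > i_{j+1} for j ∈ S; weight = x_{i₁}⋯x_{iₙ}

_∈ᵇ_ : ℕ → List ℕ → Bool
j ∈ᵇ S = any (j ≡ᵇ_) S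

fillOK : List ℕ → ℕ → List ℕ → Bool
fillOK S pos (x ∷ r@(y ∷ _)) =
  (y ≤ᵇ x) ∧ (if pos ∈ᵇ S then y <ᵇ x else true) ∧ fillOK S (suc pos) r
fillOK S pos _ = true

FSeq : ℕ → List ℕ → Set
FSeq n S = Σ (List ℕ) λ i → T ((length i ≡ᵇ n) ∧ all (1 ≤ᵇ_) i ∧ fillOK S 1 i)

-- Colored permutations C_l ≀ S_n : words of pairs (|π_i| , ε_i)

CWord : ℕ → Set
CWord l = List (ℕ × Fin l)

isZeroC : {l : ℕ} → Fin l → Bool
isZeroC e = toℕ e ≡ᵇ 0

isColPerm : {l : ℕ} → ℕ → CWord l → Bool
isColPerm n π = sameMultiset (map proj₁ π) (applyUpTo suc n)

colVecC : {l : ℕ} → CWord l → Vec ℕ (l ∸ 1)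
colVecC π = tabulate (λ j → cntBy (λ p → toℕ (Data.Product.proj₂ p) ≡ᵇ suc (toℕ j)) π)

desList : {l : ℕ} → ℕ → ℕ → CWord l → List ℕ
desList k pos ((a , e) ∷ r@((b , e') ∷ _)) =
  if (b <ᵇ a) ∧ (not (isZeroC e) ∨ (b + k ≤ᵇ a))
  then pos ∷ desList k (suc pos) r else desList k (suc pos) r
desList k pos _ = []

DES≥ : {l : ℕ} → ℕ → CWord l → List ℕ
DES≥ k π = desList k 1 π

inv< : {l : ℕ} → ℕ → CWord l → ℕ
inv< k [] = 0
inv< k ((a , e) ∷ r) =
  (if isZeroC e then cntBy (λ p → (proj₁ p <ᵇ a) ∧ (a <ᵇ proj₁ p + k)) r else 0)
  + inv< k r

RHSObj : (l n k : ℕ) → Vec ℕ (l ∸ 1) → Set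
RHSObj l n k β =
  Σ (CWord l) λ π →
    T (isColPerm n π) × inv< 2 π ≡ k × colVecC π ≡ β × FSeq n (DES≥ 2 π)

rhsWt : {l n k : ℕ} {β : Vec ℕ (l ∸ 1)} → RHSObj l n k β → List ℕ
rhsWt (π , _ , _ , _ , (i , _)) = i

-- The alphabet 𝓑.  clr v m is the letter (v+1)^m, bar v is overline((v+1)^0)
-- (absolute values are ≥ 1 by construction).

data Letter (l : ℕ) : Set where
  clr : ℕ → Fin l → Letter l
  bar : ℕ → Letter l

absL : {l : ℕ} → Letter l → ℕ
absL (clr v _) = suc v
absL (bar v) = suc v

isBar : {l : ℕ} → Letter l → Bool
isBar (clr _ _) = false
isBar (bar _) = true

isZeroUnbarred : {l : ℕ} → Letter l → Bool
isZeroUnbarred (clr _ m) = isZeroC m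
isZeroUnbarred (bar _) = false

colorL : {l : ℕ} → Letter l → ℕ
colorL (clr _ m) = toℕ m
colorL (bar _) = 0

-- order 1^0 < 1^1 < ⋯ < 1^{l-1} < bar(1^0) < 2^0 < ⋯ via keys
keyL : {l : ℕ} → Letter l → ℕ × ℕ
keyL (clr v m) = (v , toℕ m)
keyL {l} (bar v) = (v , l)

letterLt : {l : ℕ} → Letter l → Letter l → Bool
letterLt x y with keyL x | keyL y
... | (a , p) | (b , q) = (a <ᵇ b) ∨ ((a ≡ᵇ b) ∧ (p <ᵇ q))

letterEq : {l : ℕ} → Letter l → Letter l → Bool
letterEq x y with keyL x | keyL y
... | (a , p) | (b , q) = (a ≡ᵇ b) ∧ (p ≡ᵇ q)

ltW : {l : ℕ} → List (Letter l) → List (Letter l) → Bool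
ltW [] [] = false
ltW [] (_ ∷ _) = true
ltW (_ ∷ _) [] = false
ltW (x ∷ xs) (y ∷ ys) = letterLt x y ∨ (letterEq x y ∧ ltW xs ys)

rot : {A : Set} → ℕ → List A → List A
rot d w = drop d w ++ take d w

-- A primitive circular word is represented by its unique least rotation,
-- i.e. a word strictly smaller than all its proper rotations (Lyndon word).
isLyndon : {l : ℕ} → List (Letter l) → Bool
isLyndon w = (1 ≤ᵇ length w) ∧ all (λ d → ltW w (rot d w)) (applyUpTo suc (length w ∸ 1))

pairOK : {l : ℕ} → Letter l × Letter l → Bool
pairOK (x , y) =
  (if isBar x then absL y ≤ᵇ absL x else true) ∧
  (if isZeroUnbarred x then absL x ≤ᵇ absL y else true)

necklaceCond : {l : ℕ} → List (Letter l) → Bool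
necklaceCond w = all pairOK (zip w (rot 1 w)) ∧ not ((length w ≡ᵇ 1) ∧ any isBar w)

isNecklace : {l : ℕ} → List (Letter l) → Bool
isNecklace w = isLyndon w ∧ necklaceCond w

-- a finite multiset of necklaces is represented by the weakly increasing
-- (w.r.t. ltW) list of its necklace representatives
sortedW : {l : ℕ} → List (List (Letter l)) → Bool
sortedW (x ∷ r@(y ∷ _)) = not (ltW y x) ∧ sortedW r
sortedW _ = true

colVecL : {l : ℕ} → List (Letter l) → Vec ℕ (l ∸ 1)
colVecL w = tabulate (λ j → cntBy (λ x → colorL x ≡ᵇ suc (toℕ j)) w)

QObj : (l n k : ℕ) → Vec ℕ (l ∸ 1) → Set
QObj l n k β =
  Σ (List (List (Letter l))) λ o →
    T (all isNecklace o ∧ sortedW o) ×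
    length (concat o) ≡ n × cntBy isBar (concat o) ≡ k × colVecL (concat o) ≡ β

qWt : {l n k : ℕ} {β : Vec ℕ (l ∸ 1)} → QObj l n k β → List ℕ
qWt (o , _) = map absL (concat o)

-- Both sides count banners: words over the alphabet in which consecutive
-- letters obey the necklace rule and the last letter is unbarred.
--
-- A coloured permutation π with a sequence i₁ ≥ … ≥ iₙ allowed by DES≥2(π) is
-- read as a banner by listing, for v = n, …, 1, the entry i below the letter of
-- π with absolute value v, coloured as in π and barred iff that letter is
-- 0-coloured and stands before v - 1; so bars count inv<2.  Removing the largest
-- value n is invertible: n belongs at the end of its block of equal entries,
-- except that a barred n whose entry equals that of n - 1 stands directly
-- before n - 1.
--
-- A banner is turned into an ornament by its Lyndon factorization for the
-- reversed alphabet.  The first letter of each factor is then its greatest, which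
-- makes the rule across the junction of two factors equivalent to the rule
-- across the closing of each factor into a circle.

module Submission where

open import Data.Nat.Properties as ℕₚ
  using (+-comm; *-suc; suc-injective; ≡ᵇ⇒≡; ≡⇒≡ᵇ; <ᵇ⇒<; <⇒<ᵇ; ≤ᵇ⇒≤; ≤⇒≤ᵇ)
open import Level using (0ℓ)
open import Algebra.Properties.CommutativeSemigroup ℕₚ.+-commutativeSemigroup using (x∙yz≈y∙xz)
open import Axiom.UniquenessOfIdentityProofs.WithK using (uip)
open import Data.Bool using (Bool; true; false; T; _∧_; _∨_; not; if_then_else_)
open import Data.Bool.ListAction using (all; any)
open import Data.Bool.Properties using (T-irrelevant; T?; T-≡; T-∧; T-∨)
open import Data.Empty using (⊥-elim)
open import Data.Fin using (Fin; zero; suc; toℕ)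
open import Data.Fin.Properties using (toℕ-injective; toℕ<n)
open import Data.List
  using (List; []; _∷_; [_]; _++_; _∷ʳ_; length; concat; concatMap; map; zip; drop; take; filter; deduplicate;
         lookup; applyUpTo; allFin; cartesianProductWith; initLast; _∷ʳ′_)
open import Data.List.Membership.DecPropositional ℕₚ._≟_ using (_∈?_)
open import Data.List.Membership.Propositional using (_∈_; _∉_; lose)
open import Data.List.Membership.Propositional.Properties
  using (∈-map⁺; ∈-map⁻; ∈-insert; ∈-++⁻; ∈-++⁺ˡ; ∈-++⁺ʳ; ∈-∃++; ∈-AllPairs₂; ∈-filter⁺; ∈-filter⁻;
         ∈-deduplicate⁺; ∈-lookup; ∈-allFin; ∈-concatMap⁺; ∈-cartesianProductWith⁺)
open import Data.List.Membership.Propositional.Properties.WithK using (unique⇒irrelevant)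
open import Data.List.Properties as Listₚ
  using (++-assoc; ++-identityʳ; ++-conicalˡ; ++-conicalʳ; ∷-injective; ∷ʳ-injective; ∷ʳ-injectiveʳ; length-++;
         length-++-≤ʳ; length-map; length-take; length-drop; length-applyUpTo; applyUpTo-∷ʳ; take++drop≡id; map-∘)
import Data.List.Relation.Binary.Permutation.Homogeneous as Homogeneous
open import Data.List.Relation.Binary.Permutation.Propositional as Perm
  using (_↭_; ↭-sym; ↭-trans; ↭-refl; ↭⇒↭ₛ)
import Data.List.Relation.Binary.Permutation.Propositional.Properties as Permₚ
import Data.List.Relation.Binary.Permutation.Setoid.Properties as SetoidPermₚ
open import Data.List.Relation.Binary.Lex.Strict as Lex using (Lex-<; base; halt; this; next)
open import Data.List.Relation.Binary.Pointwise as Pointwise using (Pointwise-≡⇒≡)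
open import Data.List.Relation.Unary.All as All using (All; []; _∷_)
import Data.List.Relation.Unary.All.Properties as Allₚ
open import Data.List.Relation.Unary.AllPairs using (AllPairs; []; _∷_)
import Data.List.Relation.Unary.AllPairs.Properties as AllPairsₚ
open import Data.List.Relation.Unary.Any as Any using (here; there)
open import Data.List.Relation.Unary.Any.Properties using (lookup-index)
open import Data.List.Relation.Unary.Linked as Linked using (Linked; []; [-]; _∷_)
import Data.List.Relation.Unary.Linked.Properties as Linkedₚ
open import Data.List.Relation.Unary.Sorted.TotalOrder using (Sorted)
open import Data.List.Relation.Unary.Sorted.TotalOrder.Properties using (↗↭↗⇒≋)
open import Data.List.Relation.Unary.Unique.DecPropositional.Properties using (deduplicate-!)
open import Data.List.Relation.Unary.Unique.Propositional using (Unique)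
import Data.List.Relation.Unary.Unique.Propositional.Properties as Uniqueₚ
import Data.List.Sort as Sort
open import Data.Nat
  using (ℕ; zero; suc; _+_; _*_; _∸_; _≤_; _<_; z≤n; s≤s; z<s; s<s; _≡ᵇ_; _<ᵇ_; _≤ᵇ_; NonZero)
open import Data.Nat.DivMod using (_%_; _/_; m≡m%n+[m/n]*n; m%n<n)
open import Data.Nat.GeneralisedArithmetic using (fold; fold-+)
open import Data.Product using (Σ; ∃; ∃₂; _×_; _,_; proj₁; proj₂)
open import Data.Product.Relation.Binary.Lex.Strict using (×-Lex; ×-isStrictTotalOrder)
open import Data.Sum using (_⊎_; inj₁; inj₂)
open import Data.Unit using (⊤; tt)
open import Data.Vec using (Vec)
open import Data.Vec.Properties as Vecₚ using (tabulate-cong)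
open import Function using (_∘_; flip; id; case_of_; _on_)
open import Function.Bundles using (_⇔_; mk⇔; Equivalence; _↔_; mk↔ₛ′)
open import Function.Construct.Composition using (_↔-∘_)
open import Relation.Binary
  using (Rel; DecidableEquality; IsStrictTotalOrder; TotalOrder; DecTotalOrder; tri<; tri≈; tri>)
import Relation.Binary.Construct.Flip.EqAndOrd as Flip
import Relation.Binary.Construct.On as On
import Relation.Binary.Construct.StrictToNonStrict as NonStrict
open import Relation.Binary.PropositionalEquality
  using (_≡_; _≢_; refl; sym; trans; cong; cong₂; subst; subst₂; isEquivalence; resp₂; setoid; module ≡-Reasoning)
open import Relation.Nullary using (¬_; yes; no; contradiction; _×-dec_; _⊎-dec_)
open import Relation.Unary using (Decidable; Irrelevant)
open import Defs

open Equivalence using (to; from)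

-- A pair counted by `inv< 2` consists of a value v and v - 1, so each value contributes at most
-- one. The entries weakly decrease along π. Hence a barred letter, standing before the next smaller
-- value, has at least its entry, and an unbarred 0-coloured one, standing after it, at most its
-- entry: this is the necklace rule. The value 1 has no predecessor, which leaves the last letter
-- unbarred.
--
-- The alphabet puts the barred letter above all letters of its absolute value, so anything greater
-- has strictly greater absolute value. A factor of two or more letters that obeys the circular rule
-- therefore cannot end in a bar, since its greatest letter comes next; lone bars are excluded by
-- definition.
--
-- Coefficients agree when, for every content, both fibres are in bijection with the same finite
-- set. Only the banners are enumerated. Each side is tied to them by a relation that is total and
-- single-valued in both directions, which separates existence from uniqueness. `Encodes` alone does
-- not fix where a value stands in π; the descent condition does.

private
  variable
    A B : Set

-- Reflection of Boolean tests

T-ext : ∀ {b c} → (T b → T c) → (T c → T b) → b ≡ c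
T-ext {false} {false} _ _ = refl
T-ext {false} {true}  _ g = contradiction tt g
T-ext {true}  {false} f _ = contradiction tt f
T-ext {true}  {true}  _ _ = refl

T-implies : ∀ {b c} → T (if b then c else true) ⇔ (T b → T c)
T-implies {false} = mk⇔ (λ _ ()) _
T-implies {true}  = mk⇔ (λ t _ → t) (λ f → f tt)

T-not⁺ : ∀ {b} → ¬ T b → T (not b)
T-not⁺ {false} _ = tt
T-not⁺ {true}  f = contradiction tt f

T-not⁻ : ∀ {b} → T (not b) → ¬ T b
T-not⁻ {false} _ ()

-- Rotations

rotate : List A → List A
rotate []       = []
rotate (x ∷ xs) = xs ++ [ x ]

-- Iterated rotation is additive in the shift without any bound, unlike `rot`, which is the identity
-- for every shift beyond the length.
rotateBy : ℕ → List A → List A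
rotateBy k w = fold w rotate k

rotateBy-rotate : ∀ k (w : List A) → rotateBy k (rotate w) ≡ rotate (rotateBy k w)
rotateBy-rotate zero    w = refl
rotateBy-rotate (suc k) w = cong rotate (rotateBy-rotate k w)

rotateBy-+ : ∀ j k (w : List A) → rotateBy (j + k) w ≡ rotateBy j (rotateBy k w)
rotateBy-+ j k w = fold-+ w rotate j

rotateBy-++ : ∀ (u v : List A) → rotateBy (length u) (u ++ v) ≡ v ++ u
rotateBy-++ []      v = sym (++-identityʳ v)
rotateBy-++ (x ∷ u) v = begin
  rotate (rotateBy (length u) (x ∷ u ++ v))   ≡⟨ rotateBy-rotate (length u) (x ∷ u ++ v) ⟨
  rotateBy (length u) ((u ++ v) ++ [ x ])     ≡⟨ cong (rotateBy (length u)) (++-assoc u v [ x ]) ⟩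
  rotateBy (length u) (u ++ (v ++ [ x ]))     ≡⟨ rotateBy-++ u (v ++ [ x ]) ⟩
  (v ++ [ x ]) ++ u                           ≡⟨ ++-assoc v [ x ] u ⟩
  v ++ x ∷ u                                  ∎
  where open ≡-Reasoning

rotateBy-length : ∀ (w : List A) → rotateBy (length w) w ≡ w
rotateBy-length w = begin
  rotateBy (length w) w         ≡⟨ cong (rotateBy (length w)) (++-identityʳ w) ⟨
  rotateBy (length w) (w ++ []) ≡⟨ rotateBy-++ w [] ⟩
  w                             ∎
  where open ≡-Reasoning

rotateBy-multiple : ∀ k (w : List A) → rotateBy (k * length w) w ≡ w
rotateBy-multiple zero    w = refl
rotateBy-multiple (suc k) w = begin
  rotateBy (length w + k * length w) w            ≡⟨ rotateBy-+ (length w) _ w ⟩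
  rotateBy (length w) (rotateBy (k * length w) w) ≡⟨ cong (rotateBy (length w)) (rotateBy-multiple k w) ⟩
  rotateBy (length w) w                           ≡⟨ rotateBy-length w ⟩
  w                                               ∎
  where open ≡-Reasoning

rotateBy-% : ∀ k (w : List A) .{{_ : NonZero (length w)}} →
             rotateBy k w ≡ rotateBy (k % length w) w
rotateBy-% k w = begin
  rotateBy k w                                            ≡⟨ cong (λ j → rotateBy j w) (m≡m%n+[m/n]*n k n) ⟩
  rotateBy (k % n + k / n * n) w                          ≡⟨ rotateBy-+ (k % n) _ w ⟩
  rotateBy (k % n) (rotateBy (k / n * n) w)               ≡⟨ cong (rotateBy (k % n)) (rotateBy-multiple (k / n) w) ⟩
  rotateBy (k % n) w                                      ∎
  where open ≡-Reasoning
        n = length w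

rotateBy-[] : ∀ k → rotateBy k [] ≡ ([] {A = A})
rotateBy-[] zero    = refl
rotateBy-[] (suc k) = cong rotate (rotateBy-[] k)

rotateBy-inverse : ∀ k (w : List A) → ∃ λ j → rotateBy j (rotateBy k w) ≡ w
rotateBy-inverse k []         = 0 , rotateBy-[] k
-- With `suc m` the length, adding `k * m` to `k` makes `k` full turns.
rotateBy-inverse k w@(_ ∷ xs) = k * m , (begin
  rotateBy (k * m) (rotateBy k w) ≡⟨ rotateBy-+ (k * m) k w ⟨
  rotateBy (k * m + k) w          ≡⟨ cong (λ j → rotateBy j w) (trans (+-comm (k * m) k) (sym (*-suc k m))) ⟩
  rotateBy (k * suc m) w          ≡⟨ rotateBy-multiple k w ⟩
  w                               ∎)
  where open ≡-Reasoning
        m = length xs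

length-rotate : ∀ (w : List A) → length (rotate w) ≡ length w
length-rotate []       = refl
length-rotate (x ∷ xs) = trans (length-++ xs) (+-comm (length xs) 1)

length-rotateBy : ∀ k (w : List A) → length (rotateBy k w) ≡ length w
length-rotateBy zero    w = refl
length-rotateBy (suc k) w = trans (length-rotate (rotateBy k w)) (length-rotateBy k w)

rotate-injective : ∀ {u v : List A} → rotate u ≡ rotate v → u ≡ v
rotate-injective {u = []}        {[]}        _ = refl
rotate-injective {u = []}        {_ ∷ []}    ()
rotate-injective {u = []}        {_ ∷ _ ∷ _} ()
rotate-injective {u = _ ∷ []}    {[]}        ()
rotate-injective {u = _ ∷ _ ∷ _} {[]}        ()
rotate-injective {u = x ∷ u} {y ∷ v} eq with refl , refl ← ∷ʳ-injective u v eq = refl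

rotateBy≡[] : ∀ k {w : List A} → rotateBy k w ≡ [] → w ≡ []
rotateBy≡[] zero    eq = eq
rotateBy≡[] (suc k) eq = rotateBy≡[] k (rotate-injective eq)

rot≡rotateBy : ∀ k (w : List A) → k ≤ length w → rot k w ≡ rotateBy k w
rot≡rotateBy k w k≤ = sym (begin
  rotateBy k w                               ≡⟨ cong (rotateBy k) (take++drop≡id k w) ⟨
  rotateBy k (take k w ++ drop k w)          ≡⟨ cong (λ j → rotateBy j (take k w ++ drop k w)) |take| ⟨
  rotateBy (length (take k w)) (take k w ++ drop k w) ≡⟨ rotateBy-++ (take k w) (drop k w) ⟩
  drop k w ++ take k w                       ∎)
  where
  open ≡-Reasoning
  |take| : length (take k w) ≡ k
  |take| = trans (length-take k w) (ℕₚ.m≤n⇒m⊓n≡m k≤)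

Primitive : List A → Set
Primitive w = ∀ k → 0 < k → k < length w → rotateBy k w ≢ w

primitive-rotateBy : ∀ k {w : List A} → Primitive w → Primitive (rotateBy k w)
primitive-rotateBy zero    p = p
primitive-rotateBy (suc k) {w} p j 0<j j< eq =
  primitive-rotateBy k p j 0<j (subst (j <_) (length-rotate (rotateBy k w)) j<)
    (rotate-injective (trans (sym (rotateBy-rotate j (rotateBy k w))) eq))

-- Only the second case asks for a nonempty overlap, so that equal prefixes fall under the first
-- alone.
++-split : ∀ (u : List A) {v} s {t} → u ++ v ≡ s ++ t →
  (∃ λ z → s ≡ u ++ z × v ≡ z ++ t) ⊎ (∃ λ z → u ≡ s ++ z × t ≡ z ++ v × z ≢ [])
++-split []      s       eq = inj₁ (s , refl , eq)
++-split (x ∷ u) []      eq = inj₂ (x ∷ u , refl , sym eq , λ ())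
++-split (x ∷ u) (y ∷ s) eq with refl , eq′ ← ∷-injective eq | ++-split u s eq′
... | inj₁ (z , refl , q)     = inj₁ (z , refl , q)
... | inj₂ (z , refl , q , r) = inj₂ (z , refl , q , r)

≈⇒≡-isStrictTotalOrder : ∀ {_≈_ _<ᴬ_ : Rel A 0ℓ} → (∀ {x y} → x ≈ y → x ≡ y) →
  IsStrictTotalOrder _≈_ _<ᴬ_ → IsStrictTotalOrder _≡_ _<ᴬ_
≈⇒≡-isStrictTotalOrder {_<ᴬ_ = _<ᴬ_} ≈⇒≡ sto = record
  { isStrictPartialOrder = record
    { isEquivalence = isEquivalence
    ; irrefl        = S.irrefl ∘ S.Eq.reflexive
    ; trans         = S.trans
    ; <-resp-≈      = resp₂ _<ᴬ_
    }
  ; compare = λ x y → case S.compare x y of λ where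
      (tri< a b c) → tri< a (b ∘ S.Eq.reflexive) c
      (tri≈ a b c) → tri≈ a (≈⇒≡ b) c
      (tri> a b c) → tri> a (b ∘ S.Eq.reflexive) c
  }
  where module S = IsStrictTotalOrder sto

sorted-↭⇒≡ : (O : TotalOrder 0ℓ 0ℓ 0ℓ) →
  (∀ {x y} → TotalOrder._≈_ O x y → x ≡ y) →
  ∀ {xs ys} → Sorted O xs → Sorted O ys → xs ↭ ys → xs ≡ ys
sorted-↭⇒≡ O ≈⇒≡ xs↗ ys↗ xs↭ys = Pointwise-≡⇒≡ (Pointwise.map ≈⇒≡
  (↗↭↗⇒≋ O xs↗ ys↗ (Homogeneous.map (TotalOrder.Eq.reflexive O) (↭⇒↭ₛ xs↭ys))))

-- Lyndon words

module WordOrder {A : Set} {_<ᴬ_ : Rel A 0ℓ} (isSTO : IsStrictTotalOrder _≡_ _<ᴬ_) where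

  infix 4 _≺_
  _≺_ : Rel (List A) 0ℓ
  _≺_ = Lex-< _≡_ _<ᴬ_

  private
    module L = IsStrictTotalOrder isSTO

  ≺-isStrictTotalOrder : IsStrictTotalOrder _≡_ _≺_
  ≺-isStrictTotalOrder = ≈⇒≡-isStrictTotalOrder Pointwise-≡⇒≡ (Lex.<-isStrictTotalOrder isSTO)

  open IsStrictTotalOrder ≺-isStrictTotalOrder using () renaming (compare to ≺-compare)

  ≺-trans : ∀ {u v w} → u ≺ v → v ≺ w → u ≺ w
  ≺-trans = IsStrictTotalOrder.trans ≺-isStrictTotalOrder

  ≺-irrefl : ∀ {u} → ¬ u ≺ u
  ≺-irrefl = IsStrictTotalOrder.irrefl ≺-isStrictTotalOrder refl

  ≼-decTotalOrder : DecTotalOrder 0ℓ 0ℓ 0ℓ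
  ≼-decTotalOrder = record { isDecTotalOrder = NonStrict.isDecTotalOrder _≡_ _≺_ ≺-isStrictTotalOrder }

  open DecTotalOrder ≼-decTotalOrder public using ()
    renaming (_≤_ to _≼_; total to ≼-total; trans to ≼-trans; antisym to ≼-antisym; refl to ≼-refl)

  ≼⇒⊁ : ∀ {u v} → u ≼ v → ¬ v ≺ u
  ≼⇒⊁ (inj₁ u≺v)  v≺u = ≺-irrefl (≺-trans u≺v v≺u)
  ≼⇒⊁ (inj₂ refl) v≺u = ≺-irrefl v≺u

  ⊁⇒≼ : ∀ {u v} → ¬ v ≺ u → u ≼ v
  ⊁⇒≼ {u} {v} v⊀u with ≺-compare u v
  ... | tri< a _ _ = inj₁ a
  ... | tri≈ _ b _ = inj₂ b
  ... | tri> _ _ c = contradiction c v⊀u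

  ++-monoʳ-≺ : ∀ u {v w} → v ≺ w → u ++ v ≺ u ++ w
  ++-monoʳ-≺ []      p = p
  ++-monoʳ-≺ (x ∷ u) p = next refl (++-monoʳ-≺ u p)

  ++-cancelˡ-≺ : ∀ u {v w} → u ++ v ≺ u ++ w → v ≺ w
  ++-cancelˡ-≺ []      p          = p
  ++-cancelˡ-≺ (x ∷ u) (this x<x) = contradiction x<x (L.irrefl refl)
  ++-cancelˡ-≺ (x ∷ u) (next _ p) = ++-cancelˡ-≺ u p

  ≺-++ : ∀ u {v} → v ≢ [] → u ≺ u ++ v
  ≺-++ []      {[]}    v≢[] = contradiction refl v≢[]
  ≺-++ []      {_ ∷ _} _    = halt
  ≺-++ (x ∷ u) v≢[]         = next refl (≺-++ u v≢[])

  ≼-++ : ∀ u v → u ≼ u ++ v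
  ≼-++ u []        = inj₂ (sym (++-identityʳ u))
  ≼-++ u v@(_ ∷ _) = inj₁ (≺-++ u λ ())

  -- When the greater word is not longer, `halt` cannot decide the comparison. It is decided at a
  -- letter, and what is appended afterwards does not matter.
  ≺-mismatch : ∀ {u v} → u ≺ v → length v ≤ length u → ∀ x y → u ++ x ≺ v ++ y
  ≺-mismatch halt           ()
  ≺-mismatch (this p)       _       x y = this p
  ≺-mismatch (next refl p) (s≤s l)  x y = next refl (≺-mismatch p l x y)

  ≺-prefix-or-mismatch : ∀ {u v} → u ≺ v →
    (∃ λ w → v ≡ u ++ w) ⊎ (∀ x y → u ++ x ≺ v ++ y)
  ≺-prefix-or-mismatch {v = v} halt = inj₁ (v , refl)
  ≺-prefix-or-mismatch (this p) = inj₂ λ _ _ → this p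
  ≺-prefix-or-mismatch (next refl p) with ≺-prefix-or-mismatch p
  ... | inj₁ (w , refl) = inj₁ (w , refl)
  ... | inj₂ q          = inj₂ λ x y → next refl (q x y)

  -- Primitivity is kept apart from leastness because it does not mention the order: it passes
  -- unchanged between the alphabet and its reversal, while leastness is restored by rotating.
  record Lyndon (w : List A) : Set where
    constructor mkLyndon
    field
      nonempty : w ≢ []
      prim     : Primitive w
      least    : ∀ k → w ≼ rotateBy k w

  least-among : ∀ (f : ℕ → List A) n → ∃ λ k → ∀ j → j ≤ n → f k ≼ f j
  least-among f zero    = 0 , λ { zero z≤n → ≼-refl }
  least-among f (suc n) with least-among f n
  ... | k , k-least with ≼-total (f k) (f (suc n))
  ...   | inj₁ ≼n = k , λ j j≤ → case ℕₚ.m≤n⇒m<n∨m≡n j≤ of λ where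
            (inj₁ (s≤s j≤n)) → k-least j j≤n
            (inj₂ refl)      → ≼n
  ...   | inj₂ n≼ = suc n , λ j j≤ → case ℕₚ.m≤n⇒m<n∨m≡n j≤ of λ where
            (inj₁ (s≤s j≤n)) → ≼-trans n≼ (k-least j j≤n)
            (inj₂ refl)      → ≼-refl

  leastShift : List A → ℕ
  leastShift w = proj₁ (least-among (λ k → rotateBy k w) (length w))

  leastRotation : List A → List A
  leastRotation w = rotateBy (leastShift w) w

  -- The search covers shifts up to the length; any other shift is reduced modulo the length.
  leastRotation-least : ∀ w k → leastRotation w ≼ rotateBy k w
  leastRotation-least []        k = inj₂ (trans (rotateBy-[] (leastShift [])) (sym (rotateBy-[] k)))
  leastRotation-least w@(_ ∷ _) k =
    subst (leastRotation w ≼_) (sym (rotateBy-% k w))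
      (proj₂ (least-among (λ k → rotateBy k w) (length w)) _ (ℕₚ.<⇒≤ (m%n<n k (length w))))

  leastRotation-lyndon : ∀ {w} → w ≢ [] → Primitive w → Lyndon (leastRotation w)
  leastRotation-lyndon {w} w≢[] prim = mkLyndon
    (w≢[] ∘ rotateBy≡[] (leastShift w))
    (primitive-rotateBy (leastShift w) prim)
    (λ k → subst (leastRotation w ≼_) (rotateBy-+ k (leastShift w) w) (leastRotation-least w (k + leastShift w)))

  leastRotation-unique : ∀ k {w} → Lyndon w → leastRotation (rotateBy k w) ≡ w
  leastRotation-unique k {w} lyn with rotateBy-inverse k w
  ... | j , eq = ≼-antisym
    (subst (leastRotation (rotateBy k w) ≼_) eq (leastRotation-least (rotateBy k w) j))
    (subst (w ≼_) (rotateBy-+ (leastShift (rotateBy k w)) k w)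
      (Lyndon.least lyn (leastShift (rotateBy k w) + k)))

  -- Lyndon words by suffixes

  record SuffixMinimal (w : List A) : Set where
    constructor mkSuffixMinimal
    field
      nonempty : w ≢ []
      suffix   : ∀ u v → w ≡ u ++ v → u ≢ [] → v ≢ [] → w ≺ v

  strictlyLeast⇒lyndon : ∀ {w} → w ≢ [] →
    (∀ k → 0 < k → k < length w → w ≺ rotateBy k w) → Lyndon w
  strictlyLeast⇒lyndon {[]}        w≢[] _      = contradiction refl w≢[]
  strictlyLeast⇒lyndon {w@(_ ∷ _)} w≢[] w≺rot = mkLyndon w≢[] prim least
    where
    prim : Primitive w
    prim k 0<k k<n eq = ≺-irrefl (subst (w ≺_) eq (w≺rot k 0<k k<n))

    least : ∀ k → w ≼ rotateBy k w
    least k = subst (w ≼_) (sym (rotateBy-% k w)) (least-% (k % length w) (m%n<n k (length w)))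
      where
      least-% : ∀ j → j < length w → w ≼ rotateBy j w
      least-% zero    _   = ≼-refl
      least-% (suc j) j<n = inj₁ (w≺rot (suc j) z<s j<n)

  lyndon⇒strictlyLeast : ∀ {w} → Lyndon w → ∀ k → 0 < k → k < length w → w ≺ rotateBy k w
  lyndon⇒strictlyLeast (mkLyndon _ prim least) k 0<k k<n with least k
  ... | inj₁ w≺ = w≺
  ... | inj₂ w≡ = contradiction (sym w≡) (prim k 0<k k<n)

  -- Necklaces are governed by rotations, concatenation and factorization by suffixes; this lemma
  -- and its converse connect the two.
  lyndon⇒suffixMinimal : ∀ {w} → Lyndon w → SuffixMinimal w
  lyndon⇒suffixMinimal {w} lyn@(mkLyndon w≢[] prim least) = mkSuffixMinimal w≢[] suffix
    where
    suffix : ∀ u v → w ≡ u ++ v → u ≢ [] → v ≢ [] → w ≺ v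
    suffix []          _           _    u≢[] _    = contradiction refl u≢[]
    suffix (_ ∷ _)     []          _    _    v≢[] = contradiction refl v≢[]
    suffix u@(_ ∷ us)  v@(_ ∷ vs)  refl _    _    with ≺-compare w v
    ... | tri< w≺v _ _ = w≺v
    ... | tri≈ _ w≡v _ = contradiction (cong length w≡v)
            (λ eq → ℕₚ.m≢1+n+m (length v) {length us} (trans (sym eq) (length-++ u)))
    ... | tri> _ _ v≺w = contradiction v≺w v⊀w
      where
      w≺vu : w ≺ v ++ u
      w≺vu = subst (w ≺_) (rotateBy-++ u v) (lyndon⇒strictlyLeast lyn (length u) z<s
        (subst (length u <_) (sym (length-++ u)) (ℕₚ.m<m+n (length u) z<s)))
      v⊀w : ¬ v ≺ w
      v⊀w v≺w with ≺-prefix-or-mismatch v≺w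
      ... | inj₂ v≺w…        = ≺-irrefl (≺-trans w≺vu (subst (v ++ u ≺_) (++-identityʳ w) (v≺w… u [])))
      -- A smaller suffix `v` is here a prefix of `w`, so `w = v v′ = u v` with `u` and `v′` equally
      -- long. From `w ≺ v u` comes `v′ ≺ u`, and then the rotation `v′ v` would precede `u v = w`.
      ... | inj₁ (v′ , w≡vv′) = ≼⇒⊁ w≼v′v (≺-mismatch v′≺u (ℕₚ.≤-reflexive |u|≡|v′|) v v)
        where
        v′≺u : v′ ≺ u
        v′≺u = ++-cancelˡ-≺ v (subst (_≺ v ++ u) w≡vv′ w≺vu)
        |u|≡|v′| : length u ≡ length v′
        |u|≡|v′| = ℕₚ.+-cancelʳ-≡ (length v) (length u) (length v′) (begin
          length u + length v  ≡⟨ length-++ u ⟨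
          length w             ≡⟨ cong length w≡vv′ ⟩
          length (v ++ v′)     ≡⟨ length-++ v ⟩
          length v + length v′ ≡⟨ +-comm (length v) (length v′) ⟩
          length v′ + length v ∎)
          where open ≡-Reasoning
        w≼v′v : w ≼ v′ ++ v
        w≼v′v = subst (w ≼_) (trans (cong (rotateBy (length v)) w≡vv′) (rotateBy-++ v v′)) (least (length v))

  suffixMinimal⇒lyndon : ∀ {w} → SuffixMinimal w → Lyndon w
  suffixMinimal⇒lyndon {w} (mkSuffixMinimal w≢[] suffix) = strictlyLeast⇒lyndon w≢[] w≺rot
    where
    w≺rot : ∀ k → 0 < k → k < length w → w ≺ rotateBy k w
    w≺rot k 0<k k<n =
      subst₂ _≺_ (++-identityʳ w) (rot≡rotateBy k w (ℕₚ.<⇒≤ k<n))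
        (≺-mismatch
          (suffix (take k w) (drop k w) (sym (take++drop≡id k w)) take≢[] drop≢[])
          (subst (_≤ length w) (sym (length-drop k w)) (ℕₚ.m∸n≤m (length w) k))
          [] (take k w))
      where
      take≢[] : take k w ≢ []
      take≢[] eq = ℕₚ.>⇒≢ 0<k
        (trans (sym (trans (length-take k w) (ℕₚ.m≤n⇒m⊓n≡m (ℕₚ.<⇒≤ k<n)))) (cong length eq))
      drop≢[] : drop k w ≢ []
      drop≢[] eq = ℕₚ.m>n⇒m∸n≢0 k<n (trans (sym (length-drop k w)) (cong length eq))

  -- The core is `u v ≺ v`: either `u` and `v` differ at a letter, or `v = u v′`, and then `v ≺ v′`
  -- gives `u v ≺ u v′ = v`. Suffixes of `v` lie still higher, and a suffix `z v` with `z` a proper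
  -- suffix of `u` exceeds `u v` at a letter, since `z` is no longer than `u`.
  ++-suffixMinimal : ∀ {u v} → SuffixMinimal u → SuffixMinimal v → u ≺ v → SuffixMinimal (u ++ v)
  ++-suffixMinimal {u} {v} (mkSuffixMinimal u≢[] sufᵤ) (mkSuffixMinimal v≢[] sufᵥ) u≺v =
    mkSuffixMinimal (u≢[] ∘ ++-conicalˡ u v) suffix
    where
    uv≺v : u ++ v ≺ v
    uv≺v with ≺-prefix-or-mismatch u≺v
    ... | inj₂ u≺v… = subst (u ++ v ≺_) (++-identityʳ v) (u≺v… v [])
    ... | inj₁ ([] , refl) = contradiction u≺v (subst (λ t → ¬ u ≺ t) (sym (++-identityʳ u)) ≺-irrefl)
    ... | inj₁ (v′@(_ ∷ _) , v≡uv′) = subst (u ++ v ≺_) (sym v≡uv′) (++-monoʳ-≺ u (sufᵥ u v′ v≡uv′ u≢[] λ ()))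

    suffix : ∀ s t → u ++ v ≡ s ++ t → s ≢ [] → t ≢ [] → u ++ v ≺ t
    suffix s t eq s≢[] t≢[] with ++-split u s eq
    ... | inj₁ ([] , _ , refl) = uv≺v
    ... | inj₁ (z@(_ ∷ _) , _ , v≡zt) = ≺-trans uv≺v (sufᵥ z t v≡zt (λ ()) t≢[])
    ... | inj₂ (z , refl , refl , z≢[]) =
          ≺-mismatch (sufᵤ s z refl s≢[] z≢[]) (length-++-≤ʳ z {s}) v v

  -- Lyndon factorization

  NonIncreasing : List (List A) → Set
  NonIncreasing = Linked (flip _≼_)

  record IsFactorization (ms : List (List A)) : Set where
    constructor mkFactorization
    field
      factors : All SuffixMinimal ms
      sorted  : NonIncreasing ms

  -- A word below its successor merges with it into a longer Lyndon word, so merging continues until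
  -- the order is right.
  insert-factor : ∀ {u} vs → SuffixMinimal u → IsFactorization vs →
                  ∃ λ ms → concat ms ≡ u ++ concat vs × IsFactorization ms
  insert-factor {u} [] su _ = [ u ] , refl , mkFactorization (su ∷ []) [-]
  insert-factor {u} (v ∷ vs) su (mkFactorization (sv ∷ svs) srt) with ≺-compare u v
  ... | tri< u≺v _ _
          with ms , eq , fac ← insert-factor vs (++-suffixMinimal su sv u≺v) (mkFactorization svs (Linked.tail srt))
          = ms , trans eq (++-assoc u v (concat vs)) , fac
  ... | tri≈ ¬u≺v _ _ = u ∷ v ∷ vs , refl , mkFactorization (su ∷ sv ∷ svs) (⊁⇒≼ ¬u≺v ∷ srt)
  ... | tri> ¬u≺v _ _ = u ∷ v ∷ vs , refl , mkFactorization (su ∷ sv ∷ svs) (⊁⇒≼ ¬u≺v ∷ srt)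

  singleton-suffixMinimal : ∀ x → SuffixMinimal [ x ]
  singleton-suffixMinimal x = mkSuffixMinimal (λ ()) λ where
    []          _ _  u≢[] _    → contradiction refl u≢[]
    (_ ∷ [])    _ refl _  v≢[] → contradiction refl v≢[]

  factorize : ∀ w → ∃ λ ms → concat ms ≡ w × IsFactorization ms
  factorize []      = [] , refl , mkFactorization [] []
  factorize (x ∷ w)
    with vs , refl , fac  ← factorize w
    with ms , eq   , fac′ ← insert-factor vs (singleton-suffixMinimal x) fac
    = ms , eq , fac′

  -- A cut through a product of factors falls at the end of a factor or inside one. The piece of the
  -- factor before the cut is a prefix of it, hence not above it, and so not above `u`.
  bounded-suffix : ∀ {u} s {t} vs → s ≢ [] → concat vs ≡ s ++ t → All (_≼ u) vs →
                   ∃₂ λ r p → s ≡ r ++ p × p ≢ [] × p ≼ u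
  bounded-suffix s [] s≢[] eq _ = contradiction (++-conicalˡ s _ (sym eq)) s≢[]
  bounded-suffix s (v ∷ vs) s≢[] eq (v≼u ∷ vs≼u) with ++-split v s eq
  ... | inj₁ ([] , refl , _) = [] , v ++ [] , refl , s≢[] , subst (_≼ _) (sym (++-identityʳ v)) v≼u
  ... | inj₁ (z@(_ ∷ _) , refl , eq′)
          with r , p , z≡rp , p≢[] , p≼u ← bounded-suffix z vs (λ ()) eq′ vs≼u
          = v ++ r , p , trans (cong (v ++_) z≡rp) (sym (++-assoc v r p)) , p≢[] , p≼u
  ... | inj₂ (z , refl , _) = [] , s , refl , s≢[] , ≼-trans (≼-++ s z) v≼u

  head-bound : ∀ {u us} → NonIncreasing (u ∷ us) → All (_≼ u) us
  head-bound [-]      = []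
  head-bound (p ∷ ps) = Linkedₚ.Linked⇒All (flip ≼-trans) p ps

  -- A longer Lyndon prefix u z would have a proper suffix p that is a prefix of
  -- a later factor, whence p ≼ u ≺ u z, against suffix minimality.
  first-factor-maximal : ∀ {u us t} z → IsFactorization (u ∷ us) → z ≢ [] → concat us ≡ z ++ t →
                         ¬ SuffixMinimal (u ++ z)
  first-factor-maximal {u} {us} z (mkFactorization (mkSuffixMinimal u≢[] _ ∷ _) srt) z≢[] eq (mkSuffixMinimal _ suf)
    with r , p , refl , p≢[] , p≼u ← bounded-suffix z us z≢[] eq (head-bound srt)
    = ≼⇒⊁ (≼-trans p≼u (≼-++ u (r ++ p)))
        (suf (u ++ r) p (sym (++-assoc u r p)) (u≢[] ∘ ++-conicalˡ u r) p≢[])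

  factorization-unique : ∀ {us vs} → IsFactorization us → IsFactorization vs → concat us ≡ concat vs → us ≡ vs
  factorization-unique {[]} {[]} _ _ _ = refl
  factorization-unique {[]} {v ∷ vs} _ (mkFactorization (sv ∷ _) _) eq =
    contradiction (++-conicalˡ v _ (sym eq)) (SuffixMinimal.nonempty sv)
  factorization-unique {u ∷ us} {[]} (mkFactorization (su ∷ _) _) _ eq =
    contradiction (++-conicalˡ u _ eq) (SuffixMinimal.nonempty su)
  factorization-unique {u ∷ us} {v ∷ vs}
    fu@(mkFactorization (su ∷ sus) srtᵤ) fv@(mkFactorization (sv ∷ svs) srtᵥ) eq
    with ++-split u v eq
  ... | inj₁ ([] , refl , eq′) = cong₂ _∷_ (sym (++-identityʳ u))
          (factorization-unique (mkFactorization sus (Linked.tail srtᵤ)) (mkFactorization svs (Linked.tail srtᵥ)) eq′)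
  ... | inj₁ (z@(_ ∷ _) , refl , eq′) = contradiction sv (first-factor-maximal z fu (λ ()) eq′)
  ... | inj₂ (z , refl , eq′ , z≢[]) = contradiction su (first-factor-maximal z fv z≢[] eq′)

  -- The last letter is itself a suffix. If the two end letters of a longer word were equal, a
  -- nonempty rest would have to precede the empty word.
  suffixMinimal-ends : ∀ {w} → SuffixMinimal w →
    ∃₂ λ x t → ∃₂ λ s z → w ≡ x ∷ t × w ≡ s ∷ʳ z × (w ≡ [ x ] × x ≡ z ⊎ x <ᴬ z)
  suffixMinimal-ends {w} (mkSuffixMinimal w≢[] suffix) with initLast w
  ... | []            = contradiction refl w≢[]
  ... | []      ∷ʳ′ z = z , [] , [] , z , refl , refl , inj₁ (refl , refl)
  ... | (x ∷ s) ∷ʳ′ z with suffix (x ∷ s) [ z ] refl (λ ()) (λ ())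
  ...   | this x<z = x , s ∷ʳ z , x ∷ s , z , refl , refl , inj₂ x<z
  ...   | next _ p with s | p
  ...     | []    | ()
  ...     | _ ∷ _ | ()

-- Bijections and multisets

-- Both round trips follow from single-valuedness, so the maps themselves never have to be computed
-- through.
bifunctional⇒↔ : (R : A → B → Set) →
  (∀ a → ∃ (R a)) → (∀ b → ∃ λ a → R a b) →
  (∀ {a b b′} → R a b → R a b′ → b ≡ b′) →
  (∀ {a a′ b} → R a b → R a′ b → a ≡ a′) → A ↔ B
bifunctional⇒↔ R to from functional injective = mk↔ₛ′
  (proj₁ ∘ to) (proj₁ ∘ from)
  (λ b → functional (proj₂ (to (proj₁ (from b)))) (proj₂ (from b)))
  (λ a → injective (proj₂ (from (proj₁ (to a)))) (proj₂ (to a)))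

enumerated⇒finite : DecidableEquality A → {P : A → Set} → Decidable P → Irrelevant P →
  (xs : List A) → (∀ {a} → P a → a ∈ xs) → ∃ λ N → Σ A P ↔ Fin N
enumerated⇒finite {A} _≟_ {P} P? P-irr xs complete = length ys , mk↔ₛ′ position element position-element element-position
  where
  ys : List A
  ys = filter P? (deduplicate _≟_ xs)

  ∈-ys : ∀ {a} → P a → a ∈ ys
  ∈-ys p = ∈-filter⁺ P? (∈-deduplicate⁺ _≟_ (complete p)) p

  position : Σ A P → Fin (length ys)
  position (a , p) = Any.index (∈-ys p)

  element : Fin (length ys) → Σ A P
  element i = lookup ys i , proj₂ (∈-filter⁻ P? {xs = deduplicate _≟_ xs} (∈-lookup i))

  index-∈-lookup : ∀ (zs : List A) i → Any.index (∈-lookup {xs = zs} i) ≡ i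
  index-∈-lookup (z ∷ zs) zero    = refl
  index-∈-lookup (z ∷ zs) (suc i) = cong suc (index-∈-lookup zs i)

  position-element : ∀ i → position (element i) ≡ i
  -- A list without repetitions admits one membership proof per element, so the index found is the
  -- given one.
  position-element i = trans
    (cong Any.index (unique⇒irrelevant (Uniqueₚ.filter⁺ P? (deduplicate-! _≟_ xs)) _ (∈-lookup i)))
    (index-∈-lookup ys i)

  Σ-≡ : ∀ {a b} {p : P a} {q : P b} → a ≡ b → (a , p) ≡ (b , q)
  Σ-≡ {p = p} {q} refl = cong (_ ,_) (P-irr p q)

  element-position : ∀ s → element (position s) ≡ s
  element-position (a , p) = Σ-≡ (sym (lookup-index (∈-ys p)))

cntBy-↭ : ∀ (p : A → Bool) {xs ys} → xs ↭ ys → cntBy p xs ≡ cntBy p ys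
cntBy-↭ p Perm.refl = refl
cntBy-↭ p (Perm.prep x xs↭ys) with p x
... | true  = cong suc (cntBy-↭ p xs↭ys)
... | false = cntBy-↭ p xs↭ys
cntBy-↭ p (Perm.swap x y xs↭ys) with p x | p y
... | true  | true  = cong (2 +_) (cntBy-↭ p xs↭ys)
... | true  | false = cong suc (cntBy-↭ p xs↭ys)
... | false | true  = cong suc (cntBy-↭ p xs↭ys)
... | false | false = cntBy-↭ p xs↭ys
cntBy-↭ p (Perm.trans r s) = trans (cntBy-↭ p r) (cntBy-↭ p s)

count : ℕ → List ℕ → ℕ
count v = cntBy (v ≡ᵇ_)

count-∉ : ∀ {v} xs → v ∉ xs → count v xs ≡ 0
count-∉ []       _ = refl
count-∉ {v} (x ∷ xs) v∉ with v ≡ᵇ x in eq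
... | true  = contradiction (here (≡ᵇ⇒≡ v x (Equivalence.from T-≡ eq))) v∉
... | false = count-∉ xs (v∉ ∘ there)

count-self : ∀ v xs → count v (v ∷ xs) ≡ suc (count v xs)
count-self v xs rewrite Equivalence.to T-≡ (≡⇒≡ᵇ v v refl) = refl

count-∷-cancel : ∀ v x {xs ys} → count v (x ∷ xs) ≡ count v (x ∷ ys) → count v xs ≡ count v ys
count-∷-cancel v x eq with v ≡ᵇ x
... | true  = suc-injective eq
... | false = eq

count⇒↭ : ∀ xs ys → (∀ v → count v xs ≡ count v ys) → xs ↭ ys
count⇒↭ [] []       _  = ↭-refl
count⇒↭ [] (y ∷ ys) eq = contradiction (trans (eq y) (count-self y ys)) λ ()
count⇒↭ (x ∷ xs) ys eq with x ∈? ys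
... | no x∉ys = contradiction (trans (sym (count-self x xs)) (trans (eq x) (count-∉ ys x∉ys))) λ ()
... | yes x∈ys with as , bs , refl ← ∈-∃++ x∈ys =
  ↭-trans
    (Perm.prep x (count⇒↭ xs (as ++ bs) λ v →
      count-∷-cancel v x {xs} {as ++ bs} (trans (eq v) (cntBy-↭ (v ≡ᵇ_) (Permₚ.shift x as bs)))))
    (↭-sym (Permₚ.shift x as bs))

sameMultiset⇒↭ : ∀ xs ys → T (sameMultiset xs ys) → xs ↭ ys
sameMultiset⇒↭ xs ys same = count⇒↭ xs ys counts
  where
  counts : ∀ v → count v xs ≡ count v ys
  counts v with v ∈? (xs ++ ys)
  ... | yes v∈ = ≡ᵇ⇒≡ _ _ (All.lookup (Allₚ.all⁺ _ (xs ++ ys) same) v∈)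
  -- The test visits only values that occur; every other value has count zero on both sides.
  ... | no  v∉ = trans (count-∉ xs (v∉ ∘ ∈-++⁺ˡ)) (sym (count-∉ ys (v∉ ∘ ∈-++⁺ʳ xs)))

↭⇒sameMultiset : ∀ {xs ys} → xs ↭ ys → T (sameMultiset xs ys)
↭⇒sameMultiset {xs} {ys} xs↭ys = Allₚ.all⁻ _ (All.universal (λ v → ≡⇒≡ᵇ _ _ (cntBy-↭ (v ≡ᵇ_) xs↭ys)) (xs ++ ys))

rotate-↭ : ∀ (w : List A) → rotate w ↭ w
rotate-↭ []      = ↭-refl
rotate-↭ (x ∷ w) = ↭-sym (Permₚ.∷↭∷ʳ x w)

rotateBy-↭ : ∀ k (w : List A) → rotateBy k w ↭ w
rotateBy-↭ zero    w = ↭-refl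
rotateBy-↭ (suc k) w = ↭-trans (rotate-↭ (rotateBy k w)) (rotateBy-↭ k w)

concat-↭ : ∀ {us vs : List (List A)} → us ↭ vs → concat us ↭ concat vs
concat-↭ Perm.refl           = ↭-refl
concat-↭ (Perm.prep u p)     = Permₚ.++⁺ˡ u (concat-↭ p)
concat-↭ (Perm.swap u v p)   =
  ↭-trans (Permₚ.shifts u v) (Permₚ.++⁺ˡ v (Permₚ.++⁺ˡ u (concat-↭ p)))
concat-↭ (Perm.trans p q)    = ↭-trans (concat-↭ p) (concat-↭ q)

concat-map-↭ : ∀ {f : List A → List A} → (∀ w → f w ↭ w) → ∀ o → concat (map f o) ↭ concat o
concat-map-↭ f↭ []      = ↭-refl
concat-map-↭ f↭ (w ∷ o) = Permₚ.++⁺ (f↭ w) (concat-map-↭ f↭ o)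

Unique-resp-↭ : ∀ {A : Set} {xs ys : List A} → xs ↭ ys → Unique xs → Unique ys
Unique-resp-↭ p = SetoidPermₚ.Unique-resp-↭ (setoid _) (↭⇒↭ₛ p)

allPairs-middle : ∀ {A : Set} {R : Rel A 0ℓ} xs {s ys} → AllPairs R (xs ++ s ∷ ys) →
  All (λ c → R c s) xs × All (R s) ys
allPairs-middle []       (r ∷ _)  = [] , r
allPairs-middle (x ∷ xs) (r ∷ rs) =
  let p , q = allPairs-middle xs rs in All.lookup r (∈-insert xs) ∷ p , q

split-first : ∀ {A : Set} {P : A → Set} → Decidable P → ∀ xs →
  ∃₂ λ ys zs → xs ≡ ys ++ zs × All (¬_ ∘ P) ys × (zs ≡ [] ⊎ ∃₂ λ z zs′ → zs ≡ z ∷ zs′ × P z)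
split-first P? [] = [] , [] , refl , [] , inj₁ refl
split-first P? (x ∷ xs) with P? x
... | yes px = [] , x ∷ xs , refl , [] , inj₂ (x , xs , refl , px)
... | no ¬px = let ys , zs , eq , ¬ps , h = split-first P? xs in
               x ∷ ys , zs , cong (x ∷_) eq , ¬px ∷ ¬ps , h

++∷-unique : ∀ {A : Set} {f : A → ℕ} {n} xs {s ys} xs′ {s′ ys′} → f s ≡ n → f s′ ≡ n →
  All (λ c → f c < n) (xs ++ ys) → All (λ c → f c < n) (xs′ ++ ys′) →
  xs ++ s ∷ ys ≡ xs′ ++ s′ ∷ ys′ → xs ≡ xs′ × s ≡ s′ × ys ≡ ys′
++∷-unique []       []         _  _  _       _        refl = refl , refl , refl
++∷-unique []       (x′ ∷ xs′) fs _  _       (p ∷ _)  refl = contradiction fs (ℕₚ.<⇒≢ p)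
++∷-unique (x ∷ xs) []         _  fs (p ∷ _) _        refl = contradiction fs (ℕₚ.<⇒≢ p)
++∷-unique (x ∷ xs) (x′ ∷ xs′) fs fs′ (_ ∷ ps) (_ ∷ ps′) eq
  with refl , eq′ ← ∷-injective eq
  with refl , refl , refl ← ++∷-unique xs xs′ fs fs′ ps ps′ eq′
  = refl , refl , refl

cntBy-map : ∀ {A B : Set} {f : B → Bool} {g : A → Bool} {h : A → B} →
  (∀ x → f (h x) ≡ g x) → ∀ xs → cntBy f (map h xs) ≡ cntBy g xs
cntBy-map eq []       = refl
cntBy-map {g = g} eq (x ∷ xs) rewrite eq x with g x
... | true  = cong suc (cntBy-map eq xs)
... | false = cntBy-map eq xs

count-unique : ∀ {m xs} → Unique xs → m ∈ xs → count m xs ≡ 1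
count-unique {m} {.m ∷ xs} (m∉ ∷ _) (here refl) =
  trans (count-self m xs) (cong suc (count-∉ xs λ m∈ → All.lookup m∉ m∈ refl))
count-unique {m} {x ∷ xs} (x∉ ∷ u) (there m∈) with m ≡ᵇ x in eq
... | true  = contradiction (sym (≡ᵇ⇒≡ m x (from T-≡ eq))) (All.lookup x∉ m∈)
... | false = count-unique u m∈

-- Only `v + 1` lies strictly between `v` and `v + 2`: the window of `inv< 2` admits the immediate
-- predecessor alone.
isPred : ∀ m v → (v <ᵇ suc m) ∧ (suc m <ᵇ v + 2) ≡ (m ≡ᵇ v)
isPred m v = T-ext
  (λ t → let p , q = to (T-∧ {v <ᵇ suc m}) t in ≡⇒≡ᵇ m v (ℕₚ.≤-antisym
    (ℕₚ.≤-pred (ℕₚ.≤-pred (subst (suc (suc m) ≤_) (ℕₚ.+-comm v 2) (<ᵇ⇒< (suc m) (v + 2) q))))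
    (ℕₚ.≤-pred (<ᵇ⇒< v (suc m) p))))
  (λ t → subst (λ v → T ((v <ᵇ suc m) ∧ (suc m <ᵇ v + 2))) (≡ᵇ⇒≡ m v t)
    (from (T-∧ {m <ᵇ suc m}) (<⇒<ᵇ (ℕₚ.n<1+n m) , <⇒<ᵇ (ℕₚ.≤-reflexive (ℕₚ.+-comm 2 m)))))

cntBy-skip : ∀ {A B : Set} (f : B → Bool) (h : A → B) xs {s ys} → f (h s) ≡ false →
  cntBy f (map h (xs ++ s ∷ ys)) ≡ cntBy f (map h (xs ++ ys))
cntBy-skip f h xs {s} {ys} eq = trans (cntBy-↭ f (Permₚ.map⁺ h (Permₚ.shift s xs ys))) skip
  where
  skip : cntBy f (map h (s ∷ xs ++ ys)) ≡ cntBy f (map h (xs ++ ys))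
  skip rewrite eq = refl

allPairs-suffix : ∀ {A : Set} {R : Rel A 0ℓ} xs {ys} → AllPairs R (xs ++ ys) → AllPairs R ys
allPairs-suffix []       u       = u
allPairs-suffix (_ ∷ xs) (_ ∷ u) = allPairs-suffix xs u

×-irrelevant : (∀ (x y : A) → x ≡ y) → (∀ (x y : B) → x ≡ y) → (p q : A × B) → p ≡ q
×-irrelevant irrA irrB (a , b) (a′ , b′) = cong₂ _,_ (irrA a a′) (irrB b b′)

words : ℕ → List A → List (List A)
words zero    as = [ [] ]
words (suc n) as = cartesianProductWith _∷_ as (words n as)

∈-words : ∀ {as : List A} w → All (_∈ as) w → w ∈ words (length w) as
∈-words []      []         = here refl
∈-words (x ∷ w) (x∈ ∷ w⊆) = ∈-cartesianProductWith⁺ _∷_ x∈ (∈-words w w⊆)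

unzip-≡ : ∀ (xs : List A) (ys : List B) → length xs ≡ length ys → ∃ λ ps → xs ≡ map proj₁ ps × ys ≡ map proj₂ ps
unzip-≡ []       []       _  = [] , refl , refl
unzip-≡ (x ∷ xs) (y ∷ ys) eq with ps , refl , refl ← unzip-≡ xs ys (ℕₚ.suc-injective eq) = (x , y) ∷ ps , refl , refl

map-proj-injective : ∀ {ps qs : List (A × B)} → map proj₁ ps ≡ map proj₁ qs → map proj₂ ps ≡ map proj₂ qs → ps ≡ qs
map-proj-injective {ps = []}    {[]}    _ _ = refl
map-proj-injective {ps = _ ∷ _} {_ ∷ _} e f with refl , e′ ← ∷-injective e with refl , f′ ← ∷-injective f =
  cong (_ ∷_) (map-proj-injective e′ f′)

-- Ornaments and banners

module _ {l : ℕ} where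

  private
    variable
      u v w : List (Letter l)
      x y z : Letter l

  _<ᴸ_ : Rel (Letter l) 0ℓ
  _<ᴸ_ = ×-Lex _≡_ _<_ _<_ on keyL

  keyL-injective : keyL x ≡ keyL y → x ≡ y
  keyL-injective {x = clr a i} {clr b j} eq with refl ← cong proj₁ eq = cong (clr a) (toℕ-injective (cong proj₂ eq))
  keyL-injective {x = clr a i} {bar b}   eq = contradiction (cong proj₂ eq) (ℕₚ.<⇒≢ (toℕ<n i))
  keyL-injective {x = bar a}   {clr b j} eq = contradiction (sym (cong proj₂ eq)) (ℕₚ.<⇒≢ (toℕ<n j))
  keyL-injective {x = bar a}   {bar b}   eq = cong bar (cong proj₁ eq)

  <ᴸ-isStrictTotalOrder : IsStrictTotalOrder _≡_ _<ᴸ_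
  <ᴸ-isStrictTotalOrder = ≈⇒≡-isStrictTotalOrder (λ { (p , q) → keyL-injective (cong₂ _,_ p q) })
    (On.isStrictTotalOrder keyL (×-isStrictTotalOrder ℕₚ.<-isStrictTotalOrder ℕₚ.<-isStrictTotalOrder))

  -- Necklaces are given by their least rotations, whereas the factors of a
  -- banner are the greatest ones, i.e. Lyndon words for the reversed alphabet.
  module Min = WordOrder <ᴸ-isStrictTotalOrder
  module Max = WordOrder (Flip.isStrictTotalOrder <ᴸ-isStrictTotalOrder)

  <ᴸ⇒absL≤ : x <ᴸ y → absL x ≤ absL y
  <ᴸ⇒absL≤ {clr _ _} {clr _ _} (inj₁ p)       = s≤s (ℕₚ.<⇒≤ p)
  <ᴸ⇒absL≤ {clr _ _} {bar _}   (inj₁ p)       = s≤s (ℕₚ.<⇒≤ p)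
  <ᴸ⇒absL≤ {bar _}   {clr _ _} (inj₁ p)       = s≤s (ℕₚ.<⇒≤ p)
  <ᴸ⇒absL≤ {bar _}   {bar _}   (inj₁ p)       = s≤s (ℕₚ.<⇒≤ p)
  <ᴸ⇒absL≤ {clr _ _} {clr _ _} (inj₂ (p , _)) = s≤s (ℕₚ.≤-reflexive p)
  <ᴸ⇒absL≤ {clr _ _} {bar _}   (inj₂ (p , _)) = s≤s (ℕₚ.≤-reflexive p)
  <ᴸ⇒absL≤ {bar _}   {clr _ _} (inj₂ (p , _)) = s≤s (ℕₚ.≤-reflexive p)
  <ᴸ⇒absL≤ {bar _}   {bar _}   (inj₂ (p , _)) = s≤s (ℕₚ.≤-reflexive p)

  -- The key of a barred letter has second component `l`, above every colour, so the comparison must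
  -- be decided by the absolute values.
  bar-<ᴸ⇒absL< : T (isBar x) → x <ᴸ y → absL x < absL y
  bar-<ᴸ⇒absL< {bar _} {clr _ _} _ (inj₁ p)       = s<s p
  bar-<ᴸ⇒absL< {bar _} {bar _}   _ (inj₁ p)       = s<s p
  bar-<ᴸ⇒absL< {bar _} {clr _ j} _ (inj₂ (_ , p)) = contradiction (toℕ<n j) (ℕₚ.<-asym p)
  bar-<ᴸ⇒absL< {bar _} {bar _}   _ (inj₂ (_ , p)) = contradiction p (ℕₚ.<-irrefl refl)

  letterLt⇔<ᴸ : T (letterLt x y) ⇔ x <ᴸ y
  letterLt⇔<ᴸ {x} {y} = mk⇔ to′ from′
    where
    to′ : T (letterLt x y) → x <ᴸ y
    to′ t with to (T-∨ {proj₁ (keyL x) <ᵇ proj₁ (keyL y)}) t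
    ... | inj₁ p = inj₁ (<ᵇ⇒< _ _ p)
    ... | inj₂ p with q , r ← to T-∧ p = inj₂ (≡ᵇ⇒≡ _ _ q , <ᵇ⇒< _ _ r)
    from′ : x <ᴸ y → T (letterLt x y)
    from′ (inj₁ p)       = from T-∨ (inj₁ (<⇒<ᵇ p))
    from′ (inj₂ (p , q)) = from (T-∨ {proj₁ (keyL x) <ᵇ proj₁ (keyL y)})
                             (inj₂ (from T-∧ (≡⇒≡ᵇ _ _ p , <⇒<ᵇ q)))

  letterEq⇔≡ : T (letterEq x y) ⇔ x ≡ y
  letterEq⇔≡ {x} {y} = mk⇔
    (λ t → let p , q = to T-∧ t in keyL-injective (cong₂ _,_ (≡ᵇ⇒≡ _ _ p) (≡ᵇ⇒≡ _ _ q)))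
    (λ { refl → from (T-∧ {proj₁ (keyL x) ≡ᵇ proj₁ (keyL x)})
      (≡⇒≡ᵇ (proj₁ (keyL x)) _ refl , ≡⇒≡ᵇ (proj₂ (keyL x)) _ refl) })

  ltW⇒≺ : ∀ u v → T (ltW u v) → u Min.≺ v
  ltW⇒≺ []      (_ ∷ _) _ = halt
  ltW⇒≺ (x ∷ u) (y ∷ v) t with to (T-∨ {letterLt x y}) t
  ... | inj₁ p = this (to (letterLt⇔<ᴸ {x} {y}) p)
  ... | inj₂ p with q , r ← to (T-∧ {letterEq x y}) p = next (to (letterEq⇔≡ {x} {y}) q) (ltW⇒≺ u v r)

  ≺⇒ltW : u Min.≺ v → T (ltW u v)
  ≺⇒ltW halt       = tt
  ≺⇒ltW {x ∷ _} {y ∷ _} (this p) = from (T-∨ {letterLt x y}) (inj₁ (from (letterLt⇔<ᴸ {x} {y}) p))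
  ≺⇒ltW {x ∷ _} {y ∷ _} (next p q) =
    from (T-∨ {letterLt x y}) (inj₂ (from (T-∧ {letterEq x y}) (from (letterEq⇔≡ {x} {y}) p , ≺⇒ltW q)))

  isLyndon⇔ : T (isLyndon w) ⇔ Min.Lyndon w
  isLyndon⇔ {[]} = mk⇔ (λ ()) (λ lyn → contradiction refl (Min.Lyndon.nonempty lyn))
  isLyndon⇔ {w@(_ ∷ t)} = mk⇔
    (λ all-lt → Min.strictlyLeast⇒lyndon (λ ()) λ where
      (suc k) _ k<n → subst (w Min.≺_) (rot≡rotateBy (suc k) w (ℕₚ.<⇒≤ k<n))
        (ltW⇒≺ _ _ (Allₚ.applyUpTo⁻ suc (length t) (Allₚ.all⁺ _ _ all-lt) (ℕₚ.≤-pred k<n))))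
    (λ lyn → Allₚ.all⁻ _ (Allₚ.applyUpTo⁺₁ suc (length t) λ {k} k<n →
      ≺⇒ltW (subst (w Min.≺_) (sym (rot≡rotateBy (suc k) w (ℕₚ.<⇒≤ (s<s k<n))))
        (Min.lyndon⇒strictlyLeast lyn (suc k) z<s (s<s k<n)))))

  Follows : Rel (Letter l) 0ℓ
  Follows x y = (T (isBar x) → absL y ≤ absL x) × (T (isZeroUnbarred x) → absL x ≤ absL y)

  pairOK⇔ : T (pairOK (x , y)) ⇔ Follows x y
  pairOK⇔ {x} {y} = mk⇔
    (λ t → let p , q = to T-∧ t in
      ≤ᵇ⇒≤ _ _ ∘ to (T-implies {isBar x}) p , ≤ᵇ⇒≤ _ _ ∘ to (T-implies {isZeroUnbarred x}) q)
    (λ { (f , g) → from T-∧ (from T-implies (≤⇒≤ᵇ ∘ f) , from T-implies (≤⇒≤ᵇ ∘ g)) })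

  -- An unbarred letter can bound its successor only from below.
  follows-mono : ¬ T (isBar z) → absL x ≤ absL y → Follows z x → Follows z y
  follows-mono ¬bar x≤y (_ , z≤x) = (λ b → contradiction b ¬bar) , (λ t → ℕₚ.≤-trans (z≤x t) x≤y)

  Closed : List (Letter l) → Set
  Closed []      = ⊤
  Closed (x ∷ w) = Linked Follows (x ∷ w ∷ʳ x)

  record NecklaceWord (w : List (Letter l)) : Set where
    constructor mkNecklaceWord
    field
      closed       : Closed w
      not-lone-bar : ∀ x → w ≡ [ x ] → ¬ T (isBar x)

  all-pairOK⇔ : ∀ x w y → T (all pairOK (zip (x ∷ w) (w ∷ʳ y))) ⇔ Linked Follows (x ∷ w ∷ʳ y)
  all-pairOK⇔ x []      y = mk⇔ (λ t → to pairOK⇔ (proj₁ (to T-∧ t)) ∷ [-])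
                                (λ { (f ∷ _) → from T-∧ (from pairOK⇔ f , tt) })
  all-pairOK⇔ x (z ∷ w) y = mk⇔
    (λ t → let p , q = to (T-∧ {pairOK (x , z)}) t in to pairOK⇔ p ∷ to (all-pairOK⇔ z w y) q)
    (λ { (f ∷ fs) → from T-∧ (from pairOK⇔ f , from (all-pairOK⇔ z w y) fs) })

  lone-bar⇔ : T (not ((length w ≡ᵇ 1) ∧ any isBar w)) ⇔ (∀ x → w ≡ [ x ] → ¬ T (isBar x))
  lone-bar⇔ {[]}            = mk⇔ (λ _ _ ()) _
  lone-bar⇔ {clr _ _ ∷ []}  = mk⇔ (λ { _ _ refl () }) _
  lone-bar⇔ {bar a ∷ []}    = mk⇔ (λ ()) (λ f → f (bar a) refl tt)
  lone-bar⇔ {_ ∷ _ ∷ _}     = mk⇔ (λ _ _ ()) _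

  necklaceCond⇔ : T (necklaceCond w) ⇔ NecklaceWord w
  necklaceCond⇔ {[]}    = mk⇔ (λ _ → mkNecklaceWord tt λ _ ()) _
  necklaceCond⇔ {x ∷ w} = mk⇔
    (λ t → let p , q = to T-∧ t in mkNecklaceWord (to (all-pairOK⇔ x w x) p) (to (lone-bar⇔ {x ∷ w}) q))
    (λ { (mkNecklaceWord c n) → from T-∧ (from (all-pairOK⇔ x w x) c , from (lone-bar⇔ {x ∷ w}) n) })

  isNecklace⇔ : T (isNecklace w) ⇔ (Min.Lyndon w × NecklaceWord w)
  isNecklace⇔ {w} = mk⇔
    (λ t → let p , q = to (T-∧ {isLyndon w}) t in to isLyndon⇔ p , to necklaceCond⇔ q)
    (λ { (p , q) → from T-∧ (from isLyndon⇔ p , from necklaceCond⇔ q) })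

  not-ltW⇔ : T (not (ltW v u)) ⇔ u Min.≼ v
  not-ltW⇔ {v} {u} = mk⇔
    (λ t → Min.⊁⇒≼ (T-not⁻ t ∘ ≺⇒ltW))
    (λ u≼v → T-not⁺ (Min.≼⇒⊁ u≼v ∘ ltW⇒≺ v u))

  sortedW⇒linked : ∀ o → T (sortedW o) → Linked Min._≼_ o
  sortedW⇒linked []          _ = []
  sortedW⇒linked (_ ∷ [])    _ = [-]
  sortedW⇒linked (u ∷ o@(v ∷ _)) t =
    let p , q = to (T-∧ {not (ltW v u)}) t in to not-ltW⇔ p ∷ sortedW⇒linked o q

  linked⇒sortedW : ∀ {o} → Linked Min._≼_ o → T (sortedW o)
  linked⇒sortedW []      = tt
  linked⇒sortedW [-]     = tt
  linked⇒sortedW (p ∷ q) = from T-∧ (from not-ltW⇔ p , linked⇒sortedW q)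

  IsOrnament : List (List (Letter l)) → Set
  IsOrnament o = All (λ w → Min.Lyndon w × NecklaceWord w) o × Linked Min._≼_ o

  ornament⇔ : ∀ {o} → T (all isNecklace o ∧ sortedW o) ⇔ IsOrnament o
  ornament⇔ {o} = mk⇔
    (λ t → let p , q = to (T-∧ {all isNecklace o}) t in All.map (to isNecklace⇔) (Allₚ.all⁺ _ o p) , sortedW⇒linked o q)
    (λ { (p , q) → from T-∧ (Allₚ.all⁻ _ (All.map (from isNecklace⇔) p) , linked⇒sortedW q) })

  -- Banners and circular closure

  data Banner : List (Letter l) → Set where
    []  : Banner []
    [-] : ¬ T (isBar x) → Banner [ x ]
    _∷_ : Follows x y → Banner (y ∷ w) → Banner (x ∷ y ∷ w)

  linked-∷ʳ : ∀ {R : Rel (Letter l) 0ℓ} s → Linked R (s ∷ʳ x) → R x y → Linked R (s ∷ʳ x ∷ʳ y)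
  linked-∷ʳ []          _        r = r ∷ [-]
  linked-∷ʳ (_ ∷ [])    (p ∷ _)  r = p ∷ r ∷ [-]
  linked-∷ʳ (_ ∷ t ∷ s) (p ∷ ps) r = p ∷ linked-∷ʳ (t ∷ s) ps r

  linked-init : ∀ {R : Rel (Letter l) 0ℓ} s {x y} → Linked R (s ∷ʳ x ∷ʳ y) → Linked R (s ∷ʳ x) × R x y
  linked-init []          (r ∷ _)  = [-] , r
  linked-init (_ ∷ [])    (p ∷ ps) = let q , r = linked-init [] ps in p ∷ q , r
  linked-init (_ ∷ t ∷ s) (p ∷ ps) = let q , r = linked-init (t ∷ s) ps in p ∷ q , r

  necklaceWord-rotateBy : ∀ k → NecklaceWord w → NecklaceWord (rotateBy k w)
  necklaceWord-rotateBy zero    n = n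
  necklaceWord-rotateBy (suc k) n = rotate-once (necklaceWord-rotateBy k n)
    where
    closed-rotate : ∀ w → Closed w → Closed (rotate w)
    closed-rotate []          c       = c
    closed-rotate (x ∷ [])    c       = c
    closed-rotate (x ∷ y ∷ w) (p ∷ c) = linked-∷ʳ (y ∷ w) c p

    rotate-once : NecklaceWord v → NecklaceWord (rotate v)
    rotate-once {v} (mkNecklaceWord closed not-lone) =
      mkNecklaceWord (closed-rotate v closed) (λ x eq → not-lone x (rotate-injective eq))

  banner-++⁺ : ∀ s → Linked Follows (s ∷ʳ z) → Banner (z ∷ w) → Banner (s ++ z ∷ w)
  banner-++⁺ []          _        b = b
  banner-++⁺ (_ ∷ [])    (p ∷ _)  b = p ∷ b
  banner-++⁺ (_ ∷ t ∷ s) (p ∷ ps) b = p ∷ banner-++⁺ (t ∷ s) ps b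

  banner-++⁻ : ∀ s → Banner (s ++ z ∷ w) → Linked Follows (s ∷ʳ z) × Banner (z ∷ w)
  banner-++⁻ []          b       = [-] , b
  banner-++⁻ (_ ∷ [])    (p ∷ b) = p ∷ [-] , b
  banner-++⁻ (_ ∷ t ∷ s) (p ∷ b) = let ps , b′ = banner-++⁻ (t ∷ s) b in p ∷ ps , b′

  banner-tail : Banner (x ∷ w) → Banner w
  banner-tail ([-] _) = []
  banner-tail (_ ∷ b) = b

  ≼-head : (y ∷ v) Max.≼ (x ∷ w) → absL x ≤ absL y
  ≼-head (inj₁ (this x<y))   = <ᴸ⇒absL≤ x<y
  ≼-head (inj₁ (next refl _)) = ℕₚ.≤-refl
  ≼-head (inj₂ refl)         = ℕₚ.≤-refl

  closed-∷ʳ : ∀ {x t s z} → x ∷ t ≡ s ∷ʳ z → Closed (x ∷ t) ≡ Linked Follows (s ∷ʳ z ∷ʳ x)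
  closed-∷ʳ eq = cong (λ w → Linked Follows (w ∷ʳ _)) eq

  -- In a factor of two or more letters the last lies strictly below the first, which follows it
  -- around the circle. A bar there would force the absolute values to compare both ways.
  last-unbarred : NecklaceWord w → Max.SuffixMinimal w → w ≡ u ∷ʳ z → ¬ T (isBar z)
  last-unbarred {u = u} (mkNecklaceWord closed not-lone) m eq b
    with Max.suffixMinimal-ends m
  ... | x , t , s , z , refl , eq′ , ends
    with refl ← ∷ʳ-injectiveʳ u s (trans (sym eq) eq′)
    with ends
  ...   | inj₁ (eq″ , refl) = not-lone z eq″ b
  ...   | inj₂ z<x =
          ℕₚ.<⇒≱ (bar-<ᴸ⇒absL< b z<x)
            (proj₁ (proj₂ (linked-init s (subst id (closed-∷ʳ eq′) closed))) b)

  concat-banner : ∀ {ms} → Max.IsFactorization ms → All NecklaceWord ms → Banner (concat ms)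
  concat-banner {[]} _ _ = []
  concat-banner {m ∷ ms} (Max.mkFactorization (sm ∷ sms) srt) (n ∷ ns)
    with concat-banner (Max.mkFactorization sms (Linked.tail srt)) ns
  ... | rest
    with x , t , s , z , refl , eq , _ ← Max.suffixMinimal-ends sm
    = subst Banner (sym (trans (cong (_++ concat ms) eq) (++-assoc s [ z ] (concat ms))))
        (banner-++⁺ s fs (z∷rest ms sms srt rest))
    where
    linked : Linked Follows (s ∷ʳ z) × Follows z x
    linked = linked-init s (subst id (closed-∷ʳ eq) (NecklaceWord.closed n))
    fs = proj₁ linked
    ¬bar = last-unbarred n sm eq
    z∷rest : ∀ ms → All Max.SuffixMinimal ms → Max.NonIncreasing ((x ∷ t) ∷ ms) →
             Banner (concat ms) → Banner (z ∷ concat ms)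
    z∷rest [] _ _ _ = [-] ¬bar
    z∷rest ([] ∷ _) (sm′ ∷ _) _ _ = contradiction refl (Max.SuffixMinimal.nonempty sm′)
    -- The head of the next factor has absolute value at least that of `x`, so the closing rule for
    -- `z` and `x` carries over to the junction of `z` and `y`.
    z∷rest ((y ∷ _) ∷ _) _ (y≼x ∷ _) b = follows-mono ¬bar (≼-head y≼x) (proj₂ linked) ∷ b

  -- The later factors are settled first: excluding a lone bar uses that the next factor is already
  -- a necklace.
  banner-necklaces : ∀ {ms} → Max.IsFactorization ms → Banner (concat ms) → All NecklaceWord ms
  banner-necklaces {[]} _ _ = []
  banner-necklaces {m ∷ ms} (Max.mkFactorization (sm ∷ sms) srt) b
    with x , t , s , z , refl , eq , ends ← Max.suffixMinimal-ends sm
    with fs , b′ ← banner-++⁻ s (subst Banner (trans (cong (_++ concat ms) eq) (++-assoc s [ z ] (concat ms))) b)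
    = mkNecklaceWord (subst id (sym (closed-∷ʳ eq)) (linked-∷ʳ s fs z→x)) not-lone ∷ necklaces
    where
    necklaces : All NecklaceWord ms
    necklaces = banner-necklaces (Max.mkFactorization sms (Linked.tail srt)) (banner-tail b′)

    unbarred-before : ∀ {t} ms → All Max.SuffixMinimal ms → All NecklaceWord ms →
      Max.NonIncreasing ((x ∷ t) ∷ ms) →
      Banner (z ∷ concat ms) → x ∷ t ≡ [ x ] × x ≡ z ⊎ z <ᴸ x → ¬ T (isBar z)
    unbarred-before [] _ _ _ ([-] ¬b) _ = ¬b
    unbarred-before ([] ∷ _) (sm′ ∷ _) _ _ _ _ = contradiction refl (Max.SuffixMinimal.nonempty sm′)
    unbarred-before ((y ∷ v) ∷ _) _ (n ∷ _) (m′≼m ∷ _) (z→y ∷ _) ends bz with ends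
    ... | inj₂ z<x = ℕₚ.<⇒≱ (bar-<ᴸ⇒absL< bz z<x) (ℕₚ.≤-trans (≼-head m′≼m) (proj₁ z→y bz))
    -- The factor is a single barred letter. The next factor equals it, which the necklace already
    -- obtained forbids; or begins with a greater letter, against `z→y`; or begins with the same
    -- letter and continues below the empty word, which is impossible.
    ... | inj₁ (refl , refl) with m′≼m
    ...   | inj₂ refl             = NecklaceWord.not-lone-bar n x refl bz
    ...   | inj₁ (this x<y)       = ℕₚ.<⇒≱ (bar-<ᴸ⇒absL< bz x<y) (proj₁ z→y bz)
    ...   | inj₁ (next _ (base ()))

    ¬bar : ¬ T (isBar z)
    ¬bar = unbarred-before ms sms necklaces srt b′ ends

    -- With `z` unbarred only the lower bound remains, and the first letter of a factor is at least
    -- its last.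
    z→x : Follows z x
    z→x = (λ bz → contradiction bz ¬bar) , λ _ → case ends of λ where
      (inj₁ (_ , refl)) → ℕₚ.≤-refl
      (inj₂ z<x)        → <ᴸ⇒absL≤ z<x

    not-lone : ∀ y → x ∷ t ≡ [ y ] → ¬ T (isBar y)
    not-lone y refl with refl ← ∷ʳ-injectiveʳ [] s eq = ¬bar

  -- Ornaments as Lyndon factorizations

  min⇒max : Min.Lyndon w → Max.Lyndon (Max.leastRotation w)
  min⇒max lyn = Max.leastRotation-lyndon (Min.Lyndon.nonempty lyn) (Min.Lyndon.prim lyn)

  max⇒min : Max.Lyndon w → Min.Lyndon (Min.leastRotation w)
  max⇒min lyn = Min.leastRotation-lyndon (Max.Lyndon.nonempty lyn) (Max.Lyndon.prim lyn)

  module MinSort = Sort Min.≼-decTotalOrder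
  module MaxSort = Sort (Flip.decTotalOrder Max.≼-decTotalOrder)

  -- Reversing the alphabet changes the chosen rotations and also the order of words, without simply
  -- reversing it: a proper prefix comes first in both orders. The two sorted lists therefore
  -- correspond only up to permutation.
  Factors : List (List (Letter l)) → List (Letter l) → Set
  Factors o w = ∃ λ ms → Max.IsFactorization ms × concat ms ≡ w × map Max.leastRotation o ↭ ms

  min∘max : ∀ {o} → All Min.Lyndon o → map Min.leastRotation (map Max.leastRotation o) ≡ o
  min∘max []           = refl
  min∘max (_∷_ {x = w} lyn lyns) = cong₂ _∷_ (Min.leastRotation-unique (Max.leastShift w) lyn) (min∘max lyns)

  max∘min : ∀ {o} → All Max.Lyndon o → map Max.leastRotation (map Min.leastRotation o) ≡ o
  max∘min []           = refl
  max∘min (_∷_ {x = w} lyn lyns) = cong₂ _∷_ (Max.leastRotation-unique (Min.leastShift w) lyn) (max∘min lyns)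

  ornament⇒banner : ∀ {o} → IsOrnament o → ∃ λ w → Banner w × Factors o w
  ornament⇒banner {o} (lyn , _) = concat ms , concat-banner fac necklaces , ms , fac , refl , ↭-sym ms↭
    where
    ms = MaxSort.sort (map Max.leastRotation o)
    ms↭ : ms ↭ map Max.leastRotation o
    ms↭ = MaxSort.sort-↭ _
    fac : Max.IsFactorization ms
    fac = Max.mkFactorization
      (Permₚ.All-resp-↭ (↭-sym ms↭) (Allₚ.map⁺ (All.map (Max.lyndon⇒suffixMinimal ∘ min⇒max ∘ proj₁) lyn)))
      (MaxSort.sort-↗ _)
    necklaces : All NecklaceWord ms
    necklaces = Permₚ.All-resp-↭ (↭-sym ms↭)
      (Allₚ.map⁺ (All.map (λ {w} (_ , n) → necklaceWord-rotateBy (Max.leastShift w) n) lyn))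

  banner⇒ornament : Banner w → ∃ λ o → IsOrnament o × Factors o w
  banner⇒ornament {w} b with ms , refl , fac ← Max.factorize w =
    o , (Permₚ.All-resp-↭ (↭-sym o↭) (Allₚ.map⁺ (All.zipWith
          (λ {m} (lyn , n) → max⇒min lyn , necklaceWord-rotateBy (Min.leastShift m) n)
          (lyns , banner-necklaces fac b)))
        , MinSort.sort-↗ _)
    , ms , fac , refl , subst (map Max.leastRotation o ↭_) (max∘min lyns) (Permₚ.map⁺ Max.leastRotation o↭)
    where
    o = MinSort.sort (map Min.leastRotation ms)
    o↭ : o ↭ map Min.leastRotation ms
    o↭ = MinSort.sort-↭ _
    lyns : All Max.Lyndon ms
    lyns = All.map Max.suffixMinimal⇒lyndon (Max.IsFactorization.factors fac)

  factors-functional : ∀ {o} → Factors o v → Factors o w → v ≡ w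
  factors-functional (ms , fac , refl , ↭ms) (ms′ , fac′ , refl , ↭ms′) = cong concat
    (sorted-↭⇒≡ (DecTotalOrder.totalOrder (Flip.decTotalOrder Max.≼-decTotalOrder)) id
      (Max.IsFactorization.sorted fac) (Max.IsFactorization.sorted fac′) (↭-trans (↭-sym ↭ms) ↭ms′))

  -- Unique factorization recovers the necklaces up to rotation and order; least rotations and
  -- sorting fix both in an ornament.
  factors-injective : ∀ {o o′} → IsOrnament o → IsOrnament o′ → Factors o w → Factors o′ w → o ≡ o′
  factors-injective (lyn , srt) (lyn′ , srt′) (ms , fac , refl , ↭ms) (ms′ , fac′ , eq , ↭ms′)
    with refl ← Max.factorization-unique fac fac′ (sym eq)
    = sorted-↭⇒≡ (DecTotalOrder.totalOrder Min.≼-decTotalOrder) id srt srt′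
        (subst₂ _↭_ (min∘max (All.map proj₁ lyn)) (min∘max (All.map proj₁ lyn′))
          (Permₚ.map⁺ Min.leastRotation (↭-trans ↭ms (↭-sym ↭ms′))))

  factors-↭ : ∀ {o} → Factors o w → concat o ↭ w
  factors-↭ {o = o} (ms , _ , refl , ↭ms) =
    ↭-trans (↭-sym (concat-map-↭ (λ w → rotateBy-↭ (Max.leastShift w) w) o)) (concat-↭ ↭ms)

  -- Coloured permutations and banners

  Cell : Set
  Cell = (ℕ × Fin l) × ℕ

  val ent : Cell → ℕ
  val = proj₁ ∘ proj₁
  ent = proj₂

  -- The barring rule for the letter of the value m + 1, written with colour e
  -- in front of the cells ys: it is barred iff e = 0 and m is among ys.
  Matches : Letter l → Fin l → ℕ → List Cell → Set
  Matches (clr _ c) e m ys = c ≡ e × (T (isZeroC e) → m ∉ map val ys)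
  Matches (bar _)   e m ys = T (isZeroC e) × m ∈ map val ys

  -- w lists the letters of the values n, n-1, …, 1 of a coloured permutation
  -- whose letters carry the entries of a sequence i₁ ≥ … ≥ iₙ.
  Encodes : List Cell → List (Letter l) → Set
  Encodes p []      = p ≡ []
  Encodes p (b ∷ w) = ∃₂ λ xs ys → ∃ λ e →
    p ≡ xs ++ ((suc (length w) , e) , absL b) ∷ ys × Matches b e (length w) ys × Encodes (xs ++ ys) w

  private
    variable
      p q : List Cell
      c d s : Cell

  encodes-vals : ∀ w → Encodes p w → map val p ↭ applyUpTo suc (length w)
  encodes-vals []      refl = ↭-refl
  encodes-vals (b ∷ w) (xs , ys , e , refl , _ , enc) = begin
    map val (xs ++ _ ∷ ys)                          ↭⟨ Permₚ.map⁺ val (Permₚ.shift _ xs ys) ⟩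
    suc (length w) ∷ map val (xs ++ ys)             ↭⟨ Perm.prep _ (encodes-vals w enc) ⟩
    suc (length w) ∷ applyUpTo suc (length w)       ↭⟨ Permₚ.∷↭∷ʳ _ _ ⟩
    applyUpTo suc (length w) ∷ʳ suc (length w)      ≡⟨ applyUpTo-∷ʳ suc (length w) ⟩
    applyUpTo suc (suc (length w))                  ∎
    where open Perm.PermutationReasoning

  encodes-ents : ∀ w → Encodes p w → map ent p ↭ map absL w
  encodes-ents []      refl = ↭-refl
  encodes-ents (b ∷ w) (xs , ys , e , refl , _ , enc) =
    ↭-trans (Permₚ.map⁺ ent (Permₚ.shift _ xs ys)) (Perm.prep _ (encodes-ents w enc))

  encodes-length : ∀ w → Encodes p w → length p ≡ length w
  encodes-length {p} w enc = begin
    length p                            ≡⟨ length-map val p ⟨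
    length (map val p)                  ≡⟨ Permₚ.↭-length (encodes-vals w enc) ⟩
    length (applyUpTo suc (length w))   ≡⟨ length-applyUpTo suc (length w) ⟩
    length w                            ∎
    where open ≡-Reasoning

  encodes-bounds : ∀ w → Encodes p w → All (λ c → 0 < val c × val c < suc (length w)) p
  encodes-bounds w enc = Allₚ.map⁻ (Permₚ.All-resp-↭ (↭-sym (encodes-vals w enc))
    (Allₚ.applyUpTo⁺₁ suc (length w) λ i< → z<s , s<s i<))

  encodes-distinct : ∀ w → Encodes p w → Unique (map val p)
  encodes-distinct w enc = Unique-resp-↭ (↭-sym (encodes-vals w enc))
    (Uniqueₚ.applyUpTo⁺₁ suc (length w) λ i<j _ eq → ℕₚ.<⇒≢ i<j (ℕₚ.suc-injective eq))

  same-cell : Unique (map val p) → c ∈ p → d ∈ p → val c ≡ val d → c ≡ d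
  same-cell u c∈ d∈ eq with ∈-AllPairs₂ (AllPairsₚ.map⁻ u) c∈ d∈
  ... | inj₁ c≡d        = c≡d
  ... | inj₂ (inj₁ c≢d) = contradiction eq c≢d
  ... | inj₂ (inj₂ d≢c) = contradiction (sym eq) d≢c

  -- Equal entries are allowed exactly off the descents. Negating the condition of `DES≥ 2` leaves a
  -- weak ascent, or a drop by one from a 0-coloured letter.
  Step : Rel Cell 0ℓ
  Step ((a , e) , x) ((b , _) , y) = y < x ⊎ (y ≡ x × (a ≤ b ⊎ T (isZeroC e) × a ≡ suc b))

  Good : List Cell → Set
  Good = Linked Step

  step⇒≥ : Step c d → ent d ≤ ent c
  step⇒≥ (inj₁ lt)       = ℕₚ.<⇒≤ lt
  step⇒≥ (inj₂ (eq , _)) = ℕₚ.≤-reflexive eq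

  good-middle : ∀ xs {s ys} → Good (xs ++ s ∷ ys) → All (λ c → ent s ≤ ent c) xs × All (λ d → ent d ≤ ent s) ys
  good-middle xs g = allPairs-middle xs
    (Linkedₚ.Linked⇒AllPairs (flip ℕₚ.≤-trans) (Linked.map (λ {c} {d} → step⇒≥ {c} {d}) g))

  -- A maximal value `s` can precede `d` inside a block only as `d + 1`, and then `c < s` yields the
  -- ascent `c ≤ d`.
  step-skip : val c < val s → val d < val s → Step c s → Step s d → Step c d
  step-skip _   _   (inj₁ s<c)        (inj₁ d<s)        = inj₁ (ℕₚ.<-trans d<s s<c)
  step-skip _   _   (inj₁ s<c)        (inj₂ (refl , _)) = inj₁ s<c
  step-skip _   _   (inj₂ (refl , _)) (inj₁ d<s)        = inj₁ d<s
  step-skip _   d<s (inj₂ (refl , _)) (inj₂ (refl , inj₁ s≤d)) = contradiction s≤d (ℕₚ.<⇒≱ d<s)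
  step-skip c<s _   (inj₂ (refl , _)) (inj₂ (refl , inj₂ (_ , refl))) = inj₂ (refl , inj₁ (ℕₚ.≤-pred c<s))

  good-delete : ∀ xs {s ys} → All (λ c → val c < val s) (xs ++ ys) → Good (xs ++ s ∷ ys) → Good (xs ++ ys)
  good-delete []           _             g             = Linked.tail g
  good-delete (c ∷ []) {ys = []}    _    _             = [-]
  good-delete (c ∷ []) {s} {d ∷ ys} (c< ∷ d< ∷ _) (cs ∷ sd ∷ g) = step-skip {c} {s} {d} c< d< cs sd ∷ g
  good-delete (c ∷ c′ ∷ xs) (_ ∷ b)      (r ∷ g)       = r ∷ good-delete (c′ ∷ xs) b g

  good-insert : ∀ xs {s ys} → Good (xs ++ ys) → All (λ c → Step c s) xs → Good (s ∷ ys) → Good (xs ++ s ∷ ys)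
  good-insert []            _       _        h = h
  good-insert (c ∷ [])      _       (cs ∷ _) h = cs ∷ h
  good-insert (c ∷ c′ ∷ xs) (r ∷ g) (_ ∷ cs) h = r ∷ good-insert (c′ ∷ xs) g cs h

  bounded : ∀ w → Encodes p w → All (λ c → val c < suc (length w)) p
  bounded w enc = All.map proj₂ (encodes-bounds w enc)

  -- The next letter belongs to the preceding value. For an unbarred 0-coloured `b` its cell lies in
  -- `xs`, for a barred `b` in `ys`, and entries weakly decrease from left to right.
  matches⇒follows : ∀ {b b′} w xs {ys e} → Good (xs ++ ((suc (suc (length w)) , e) , absL b) ∷ ys) →
    Matches b e (suc (length w)) ys → Encodes (xs ++ ys) (b′ ∷ w) → Follows b b′
  matches⇒follows {clr _ _} w xs {ys} g (refl , ∉ys) enc@(xs′ , ys′ , _ , eq , _ , _) = (λ ()) , λ z →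
    case ∈-++⁻ xs (subst (_ ∈_) (sym eq) (∈-insert xs′)) of λ where
      (inj₁ c∈xs) → All.lookup (proj₁ (good-middle xs g)) c∈xs
      (inj₂ c∈ys) → contradiction (∈-map⁺ val c∈ys) (∉ys z)
  matches⇒follows {bar _} {b′} w xs {ys} g (_ , ∈ys) enc@(xs′ , ys′ , _ , eq , _ , _) = (λ _ → b′≤) , λ ()
    where
    b′≤ : absL b′ ≤ _
    b′≤ with d , d∈ys , m≡d ← ∈-map⁻ val ∈ys
      with refl ← same-cell (encodes-distinct (b′ ∷ w) enc)
             (subst (_ ∈_) (sym eq) (∈-insert xs′)) (∈-++⁺ʳ xs d∈ys) m≡d
      = All.lookup (proj₂ (good-middle xs g)) d∈ys

  good⇒banner : ∀ w → Encodes p w → Good p → Banner w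
  good⇒banner []           _ _ = []
  good⇒banner (clr _ _ ∷ []) _ _ = [-] λ ()
  good⇒banner (bar _ ∷ []) (xs , ys , _ , _ , (_ , ∈ys) , enc) _
    with refl ← ++-conicalʳ xs ys enc with () ← ∈ys
  good⇒banner (b ∷ w@(_ ∷ w′)) (xs , ys , _ , refl , m , enc) g =
    matches⇒follows {b} w′ xs g m enc ∷
    good⇒banner w enc (good-delete xs (bounded w enc) g)

  -- The largest value has one place among the cells; its colour and whether its predecessor stands
  -- behind it determine the letter.
  encodes-functional : ∀ w w′ → Encodes p w → Encodes p w′ → w ≡ w′
  encodes-functional [] []       _ _ = refl
  encodes-functional [] (b ∷ w′) refl (xs , ys , _ , eq , _ , _) with () ← ++-conicalʳ xs _ (sym eq)
  encodes-functional (b ∷ w) []  (xs , ys , _ , eq , _ , _) refl with () ← ++-conicalʳ xs _ (sym eq)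
  encodes-functional (b ∷ w) (b′ ∷ w′) encₚ@(xs , ys , e , refl , m , enc) encₚ′@(xs′ , ys′ , e′ , eq , m′ , enc′)
    with |w|≡ ← ℕₚ.suc-injective (trans (sym (encodes-length (b ∷ w) encₚ)) (encodes-length (b′ ∷ w′) encₚ′))
    with refl , s≡ , refl ← ++∷-unique {f = val} xs xs′ refl (cong suc (sym |w|≡)) (bounded w enc)
           (subst (λ k → All (λ c → val c < suc k) _) (sym |w|≡) (bounded w′ enc′)) eq
    with refl ← encodes-functional w w′ enc enc′
    = cong (_∷ w) (letter b b′ (cong (proj₂ ∘ proj₁) s≡) (cong proj₂ s≡) m m′)
    where
    letter : ∀ b b′ {e e′ m} → e ≡ e′ → absL b ≡ absL b′ → Matches b e m ys → Matches b′ e′ m ys → b ≡ b′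
    letter (clr a _) (clr _ _) refl refl (refl , _) (refl , _) = refl
    letter (clr a _) (bar _)   refl refl (refl , ∉ys) (z , ∈ys) = contradiction ∈ys (∉ys z)
    letter (bar a)   (clr _ _) refl refl (z , ∈ys) (refl , ∉ys) = contradiction ∈ys (∉ys z)
    letter (bar a)   (bar _)   refl refl _          _          = refl

  linked-suffix : ∀ xs → Good (xs ++ p) → Good p
  linked-suffix []       g = g
  linked-suffix (_ ∷ xs) g = linked-suffix xs (Linked.tail g)

  -- Moving the new maximal value past t is possible only if t is its
  -- predecessor in the same block, and this changes whether its letter is barred.
  no-second-position : ∀ {b e a m} xs {t} zs {ys} →
    Unique (map val (xs ++ t ∷ zs ++ ys)) → val t < suc m →
    Matches b e m (t ∷ zs ++ ys) → Matches b e m ys →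
    Good (xs ++ ((suc m , e) , a) ∷ t ∷ zs ++ ys) → ¬ Good ((xs ++ t ∷ zs) ++ ((suc m , e) , a) ∷ ys)
  no-second-position xs {t} zs u t< m m′ g g′ with Linked.head (linked-suffix xs g)
  ... | inj₁ t<s               = ℕₚ.<⇒≱ t<s (All.lookup (proj₁ (good-middle (xs ++ t ∷ zs) g′)) (∈-insert xs))
  ... | inj₂ (_ , inj₁ s≤t)    = ℕₚ.<⇒≱ t< s≤t
  no-second-position {clr _ _} xs zs u t< (refl , ∉t) _ g g′
      | inj₂ (_ , inj₂ (z , refl)) = ∉t z (here refl)
  no-second-position {bar _} xs zs u t< _ (_ , ∈ys) g g′
      | inj₂ (_ , inj₂ (_ , refl)) with d , d∈ys , eq ← ∈-map⁻ val ∈ys =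
        All.lookup (proj₂ (allPairs-middle xs (AllPairsₚ.map⁻ u))) (∈-++⁺ʳ zs d∈ys) eq

  matches-colour : ∀ b {e e′ m ys ys′} → Matches b e m ys → Matches b e′ m ys′ → e ≡ e′
  matches-colour (clr _ _) (refl , _) (refl , _) = refl
  matches-colour (bar _)   (z , _)    (z′ , _)   = toℕ-injective (trans (≡ᵇ⇒≡ _ _ z) (sym (≡ᵇ⇒≡ _ _ z′)))

  -- A banner fixes the colour and entry of every value but not its place. Once the smaller values
  -- agree, `Good` leaves a single place for the largest.
  encodes-injective : ∀ w → Encodes p w → Encodes q w → Good p → Good q → p ≡ q
  encodes-injective []      refl refl _ _ = refl
  encodes-injective (b ∷ w) (xs , ys , e , refl , m , enc) (xs′ , ys′ , e′ , refl , m′ , enc′) g g′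
    with refl ← matches-colour b m m′
    with rest ← encodes-injective w enc enc′
                  (good-delete xs (bounded w enc) g) (good-delete xs′ (bounded w enc′) g′)
    with ++-split xs xs′ rest
  ...   | inj₁ ([] , refl , refl) = cong (_++ _ ∷ ys) (sym (++-identityʳ xs))
  ...   | inj₁ (t ∷ zs , refl , refl) = contradiction g′
          (no-second-position {b} xs zs (encodes-distinct w enc)
            (All.lookup (bounded w enc) (∈-insert xs)) m m′ g)
  ...   | inj₂ ([] , _ , _ , z≢[]) = contradiction refl z≢[]
  ...   | inj₂ (t ∷ zs , refl , refl , _) = contradiction g
          (no-second-position {b} xs′ zs (encodes-distinct w enc′)
            (All.lookup (bounded w enc′) (∈-insert xs′)) m′ m g′)

  vals-delete : ∀ {n} xs {ys} → map val (xs ++ s ∷ ys) ↭ applyUpTo suc (suc n) → val s ≡ suc n →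
                map val (xs ++ ys) ↭ applyUpTo suc n
  vals-delete {n = n} xs {ys} vals refl = Permₚ.drop-∷ (begin
    suc n ∷ map val (xs ++ ys)   ↭⟨ Permₚ.map⁺ val (Permₚ.shift _ xs ys) ⟨
    map val (xs ++ _ ∷ ys)       ↭⟨ vals ⟩
    applyUpTo suc (suc n)        ≡⟨ applyUpTo-∷ʳ suc n ⟨
    applyUpTo suc n ∷ʳ suc n     ↭⟨ Permₚ.∷↭∷ʳ _ _ ⟨
    suc n ∷ applyUpTo suc n      ∎)
    where open Perm.PermutationReasoning

  encode : ∀ n p → map val p ↭ applyUpTo suc n → All (λ c → 1 ≤ ent c) p → ∃ λ w → length w ≡ n × Encodes p w
  encode zero    []      _    _ = [] , refl , refl
  encode zero    (_ ∷ _) vals _ = contradiction vals Permₚ.¬x∷xs↭[]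
  encode (suc n) p vals pos
    with ((_ , e) , x) , c∈p , refl ← ∈-map⁻ val (Permₚ.∈-resp-↭ (↭-sym vals)
           (subst (suc n ∈_) (applyUpTo-∷ʳ suc n) (∈-++⁺ʳ (applyUpTo suc n) (here refl))))
    with xs , ys , refl ← ∈-∃++ c∈p
    -- Letters store the absolute value minus one, so the positive entry is taken apart as `suc a`.
    with s≤s {n = a} z≤n ∷ pos′ ← Permₚ.All-resp-↭ (Permₚ.shift _ xs ys) pos
    with w , refl , enc ← encode n (xs ++ ys) (vals-delete xs vals refl) pos′
    with T? (isZeroC e) ×-dec (length w ∈? map val ys)
  ... | yes zero∧∈ = bar a ∷ w , refl , xs , ys , e , refl , zero∧∈ , enc
  ... | no  ¬both  = clr a e ∷ w , refl , xs , ys , e , refl , (refl , λ z ∈ys → ¬both (z , ∈ys)) , enc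

  good-∷ : Good p → (p ≡ [] ⊎ ∃₂ λ d p′ → p ≡ d ∷ p′ × Step s d) → Good (s ∷ p)
  good-∷ _ (inj₁ refl)                 = [-]
  good-∷ g (inj₂ (_ , _ , refl , step)) = step ∷ g

  ≥⇒step : val c ≤ val s → ¬ ent c < ent s → Step c s
  ≥⇒step c≤s c≮s with ℕₚ.m≤n⇒m<n∨m≡n (ℕₚ.≮⇒≥ c≮s)
  ... | inj₁ lt = inj₁ lt
  ... | inj₂ eq = inj₂ (eq , inj₁ c≤s)

  -- Decoding gives a barred letter the colour 0, which exists because there is at least one colour.
  bar-zero : ∀ {n} → 1 ≤ n → ∃ λ (e : Fin n) → T (isZeroC e)
  bar-zero (s≤s _) = zero , tt

  -- The cell is placed before the first one that must come after it. For a coloured letter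
  -- everything behind has a smaller entry, so by `Follows` a 0-coloured one has no predecessor
  -- there. For a barred letter `Follows` gives the predecessor an entry at most `suc a`, which
  -- makes it a stopping cell, so it lies behind.
  insert-letter : 1 ≤ l → ∀ b w → Banner (b ∷ w) → Encodes p w → Good p → ∃ λ q → Encodes q (b ∷ w) × Good q
  insert-letter {p} 1≤l (clr a e) w ban enc g
    with xs , ys , refl , xs≮ , h ← split-first (λ c → ent c ℕₚ.<? suc a) p
    = _ , (xs , ys , e , refl , (refl , λ z ∈ys → late w ban enc z (∈-map⁻ val ∈ys)) , enc)
        , good-insert xs g
            (All.zipWith (λ {c} (c≮ , c<) → ≥⇒step {c} {(suc (length w) , e) , suc a} (ℕₚ.<⇒≤ c<) c≮)
              (xs≮ , Allₚ.++⁻ˡ xs (bounded w enc)))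
            (good-∷ (linked-suffix xs g) (case h of λ where
              (inj₁ ys≡[])               → inj₁ ys≡[]
              (inj₂ (d , ys′ , eq , d<)) → inj₂ (d , ys′ , eq , inj₁ d<)))
    where
    ys< : ∀ {ys} → Good ys → (ys ≡ [] ⊎ ∃₂ λ d ys′ → ys ≡ d ∷ ys′ × ent d < suc a) → All (λ c → ent c < suc a) ys
    ys< _ (inj₁ refl)               = []
    ys< g (inj₂ (_ , _ , refl , d<)) = d< ∷ All.map (λ c≤d → ℕₚ.≤-<-trans c≤d d<) (proj₂ (good-middle [] g))

    late : ∀ w → Banner (clr a e ∷ w) → Encodes (xs ++ ys) w → T (isZeroC e) →
           ¬ ∃ λ d → d ∈ ys × length w ≡ val d
    late []       _       enc _ (d , d∈ys , _) with () ← subst (d ∈_) (++-conicalʳ xs ys enc) d∈ys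
    late (b′ ∷ w) (f ∷ _) enc′@(xs′ , _ , _ , eq , _) z (d , d∈ys , m≡d)
      with refl ← same-cell (encodes-distinct (b′ ∷ w) enc′)
             (subst (_ ∈_) (sym eq) (∈-insert xs′)) (∈-++⁺ʳ xs d∈ys) m≡d
      = ℕₚ.<⇒≱ (All.lookup (ys< (linked-suffix xs g) h) d∈ys) (proj₂ f z)
  insert-letter _ (bar a) [] ([-] ¬bar) _ _ = contradiction tt ¬bar
  insert-letter {p} 1≤l (bar a) w@(b′ ∷ w′) (f ∷ _) enc@(xs′ , _ , _ , eq , _) g
    with e , z ← bar-zero 1≤l
    with xs , ys , refl , ¬stop , h ←
           split-first (λ c → (ent c ℕₚ.<? suc a) ⊎-dec ((ent c ℕₚ.≟ suc a) ×-dec (val c ℕₚ.≟ length w))) p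
    = _ , (xs , ys , e , refl , (z , ∈ys) , enc)
        , good-insert xs g
            (All.zipWith (λ {c} (c≮ , c<) → ≥⇒step {c} {(suc (length w) , e) , suc a} (ℕₚ.<⇒≤ c<) (c≮ ∘ inj₁))
              (¬stop , Allₚ.++⁻ˡ xs (bounded w enc)))
            (good-∷ (linked-suffix xs g) (case h of λ where
              (inj₁ ys≡[]) → inj₁ ys≡[]
              (inj₂ (d , ys′ , eq , inj₁ d<)) → inj₂ (d , ys′ , eq , inj₁ d<)
              -- The stopping cell is the predecessor in the same block: a drop by one from a
              -- 0-coloured letter, hence no descent.
              (inj₂ (d , ys′ , eq , inj₂ (d≡ , refl))) → inj₂ (d , ys′ , eq , inj₂ (d≡ , inj₂ (z , refl)))))
    where
    ∈ys : length w ∈ map val ys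
    ∈ys with ∈-++⁻ xs (subst (_ ∈_) (sym eq) (∈-insert xs′))
    ... | inj₂ c∈ys = ∈-map⁺ val c∈ys
    ... | inj₁ c∈xs with ℕₚ.m≤n⇒m<n∨m≡n (proj₁ f tt)
    ...   | inj₁ lt = contradiction (inj₁ lt) (All.lookup ¬stop c∈xs)
    ...   | inj₂ c≡ = contradiction (inj₂ (c≡ , refl)) (All.lookup ¬stop c∈xs)

  decode : 1 ≤ l → ∀ w → Banner w → ∃ λ p → Encodes p w × Good p
  decode 1≤l []      _ = [] , refl , []
  decode 1≤l (b ∷ w) ban with p , enc , g ← decode 1≤l w (banner-tail ban) =
    insert-letter 1≤l b w ban enc g

  -- Inversions and colours

  smallerBy1 : ℕ × Fin l → List Cell → ℕ
  smallerBy1 (a , e) ys =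
    if isZeroC e then cntBy (λ p → (proj₁ p <ᵇ a) ∧ (a <ᵇ proj₁ p + 2)) (map proj₁ ys) else 0

  -- No cell in front counts a larger value as smaller than itself, so only the pairs formed by `s`
  -- with what follows are added.
  inv-insert : ∀ xs {s ys} → All (λ c → val c < val s) xs →
    inv< 2 (map proj₁ (xs ++ s ∷ ys)) ≡ smallerBy1 (proj₁ s) ys + inv< 2 (map proj₁ (xs ++ ys))
  inv-insert []                  _         = refl
  inv-insert (((a , e) , _) ∷ xs) {s} {ys} (a<s ∷ xs<) = begin
    smallerBy1 (a , e) (xs ++ s ∷ ys) + inv< 2 (map proj₁ (xs ++ s ∷ ys))
      ≡⟨ cong₂ _+_ (cong (λ k → if isZeroC e then k else 0) (cntBy-skip _ proj₁ xs s-larger)) (inv-insert xs xs<) ⟩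
    smallerBy1 (a , e) (xs ++ ys) + (smallerBy1 (proj₁ s) ys + inv< 2 (map proj₁ (xs ++ ys)))
      ≡⟨ x∙yz≈y∙xz (smallerBy1 (a , e) (xs ++ ys)) (smallerBy1 (proj₁ s) ys) _ ⟩
    smallerBy1 (proj₁ s) ys + (smallerBy1 (a , e) (xs ++ ys) + inv< 2 (map proj₁ (xs ++ ys))) ∎
    where
    open ≡-Reasoning
    s-larger : (val s <ᵇ a) ∧ (a <ᵇ val s + 2) ≡ false
    s-larger = T-ext (λ t → ℕₚ.<-asym a<s (<ᵇ⇒< (val s) a (proj₁ (to (T-∧ {val s <ᵇ a}) t)))) (λ ())

  smallerBy1-matches : ∀ b {e m ys} → Unique (map val ys) → Matches b e m ys →
    smallerBy1 (suc m , e) ys ≡ (if isBar b then 1 else 0)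
  smallerBy1-matches b {e} {m} {ys} u mat with isZeroC e in zero?
  smallerBy1-matches (clr _ _) u (refl , _) | false = refl
  smallerBy1-matches (bar _)   u (z , _)    | false = contradiction (subst T zero? z) λ ()
  smallerBy1-matches b {e} {m} {ys} u mat   | true  = trans
    (trans (cntBy-map {f = λ p → (proj₁ p <ᵇ suc m) ∧ (suc m <ᵇ proj₁ p + 2)} {h = proj₁} (λ c → isPred m (val c)) ys) (sym (cntBy-map (λ _ → refl) ys)))
    (number b mat)
    where
    number : ∀ b → Matches b e m ys → count m (map val ys) ≡ (if isBar b then 1 else 0)
    number (clr _ _) (refl , ∉ys) = count-∉ _ (∉ys (from T-≡ zero?))
    number (bar _)   (_ , ∈ys)    = count-unique u ∈ys

  encodes-inv : ∀ w → Encodes p w → inv< 2 (map proj₁ p) ≡ cntBy isBar w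
  encodes-inv []      refl = refl
  encodes-inv (b ∷ w) (xs , ys , e , refl , m , enc) = begin
    inv< 2 (map proj₁ (xs ++ _ ∷ ys))
      ≡⟨ inv-insert xs (Allₚ.++⁻ˡ xs (bounded w enc)) ⟩
    smallerBy1 (suc (length w) , e) ys + inv< 2 (map proj₁ (xs ++ ys))
      ≡⟨ cong₂ _+_ (smallerBy1-matches b ys-unique m) (encodes-inv w enc) ⟩
    (if isBar b then 1 else 0) + cntBy isBar w
      ≡⟨ if-suc (isBar b) ⟩
    cntBy isBar (b ∷ w) ∎
    where
    open ≡-Reasoning
    ys-unique : Unique (map val ys)
    ys-unique = AllPairsₚ.map⁺ (allPairs-suffix xs (AllPairsₚ.map⁻ (encodes-distinct w enc)))
    if-suc : ∀ t {n} → (if t then 1 else 0) + n ≡ (if t then suc n else n)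
    if-suc true  = refl
    if-suc false = refl

  encodes-colour : ∀ j w → Encodes p w →
    cntBy (λ c → toℕ (proj₂ c) ≡ᵇ suc j) (map proj₁ p) ≡ cntBy (λ x → colorL x ≡ᵇ suc j) w
  encodes-colour j []      refl = refl
  encodes-colour j (b ∷ w) (xs , ys , e , refl , m , enc)
    = trans (cntBy-↭ _ (Permₚ.map⁺ proj₁ (Permₚ.shift _ xs ys)))
        (cong₂ (λ t k → if t then suc k else k) (colour b m) (encodes-colour j w enc))
    where
    colour : ∀ b → Matches b e (length w) ys → (toℕ e ≡ᵇ suc j) ≡ (colorL b ≡ᵇ suc j)
    colour (clr _ _) (refl , _) = refl
    colour (bar _)   (z , _)    = cong (_≡ᵇ suc j) (≡ᵇ⇒≡ (toℕ e) 0 z)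

  encodes-colVec : ∀ w → Encodes p w → colVecC (map proj₁ p) ≡ colVecL w
  encodes-colVec w enc = tabulate-cong (λ j → encodes-colour (toℕ j) w enc)

  -- Descent sets as a local condition

  ∉-desList : ∀ {i} k pos (π : CWord l) → i < pos → (i ∈ᵇ desList k pos π) ≡ false
  ∉-desList k pos []      _ = refl
  ∉-desList k pos (_ ∷ []) _ = refl
  ∉-desList {i} k pos ((a , e) ∷ π@((b , _) ∷ _)) i<pos
    with (b <ᵇ a) ∧ (not (isZeroC e) ∨ (b + k ≤ᵇ a)) | ∉-desList k (suc pos) π (ℕₚ.m<n⇒m<1+n i<pos)
  ... | false | ∉π = ∉π
  ... | true  | ∉π = cong₂ _∨_ (T-ext (λ t → ℕₚ.<⇒≢ i<pos (≡ᵇ⇒≡ i pos t)) (λ ())) ∉π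

  fillOK-∷ : ∀ {i} S pos → i < pos → ∀ x → fillOK (i ∷ S) pos x ≡ fillOK S pos x
  fillOK-∷ S pos i<pos []          = refl
  fillOK-∷ S pos i<pos (_ ∷ [])    = refl
  fillOK-∷ {i} S pos i<pos (x ∷ x′@(y ∷ _)) = cong₂ (λ t u → (y ≤ᵇ x) ∧ (if t then y <ᵇ x else true) ∧ u)
    (cong (_∨ (pos ∈ᵇ S)) (T-ext (λ t → ℕₚ.<⇒≢ i<pos (sym (≡ᵇ⇒≡ pos i t))) (λ ())))
    (fillOK-∷ S (suc pos) (ℕₚ.m<n⇒m<1+n i<pos) x′)

  descends : Cell → Cell → Bool
  descends ((a , e) , _) ((b , _) , _) = (b <ᵇ a) ∧ (not (isZeroC e) ∨ (b + 2 ≤ᵇ a))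

  step⇔ : (T (ent d ≤ᵇ ent c) × T (if descends c d then ent d <ᵇ ent c else true)) ⇔ Step c d
  step⇔ {(b , e′) , y} {(a , e) , x} = mk⇔ to′ from′
    where
    dc = (b <ᵇ a) ∧ (not (isZeroC e) ∨ (b + 2 ≤ᵇ a))
    no-descent : ¬ T dc → a ≤ b ⊎ T (isZeroC e) × a ≡ suc b
    no-descent ¬d with a ℕₚ.≤? b
    ... | yes a≤b = inj₁ a≤b
    ... | no  a≰b = inj₂ (zero-e , ℕₚ.≤-antisym a≤1+b (ℕₚ.≰⇒> a≰b))
      where
      b<a = <⇒<ᵇ (ℕₚ.≰⇒> a≰b)
      zero-e : T (isZeroC e)
      zero-e with T? (isZeroC e)
      ... | yes z = z
      ... | no ¬z = contradiction (from T-∧ (b<a , from T-∨ (inj₁ (T-not⁺ ¬z)))) ¬d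
      a≤1+b : a ≤ suc b
      a≤1+b with a ℕₚ.≤? suc b
      ... | yes p = p
      ... | no ¬p = contradiction (from T-∧ (b<a , from (T-∨ {not (isZeroC e)})
              (inj₂ (≤⇒≤ᵇ (subst (_≤ a) (ℕₚ.+-comm 2 b) (ℕₚ.≰⇒> ¬p)))))) ¬d

    to′ : T (y ≤ᵇ x) × T (if dc then y <ᵇ x else true) → Step ((a , e) , x) ((b , e′) , y)
    to′ (y≤x , strict) with ℕₚ.m≤n⇒m<n∨m≡n (≤ᵇ⇒≤ y x y≤x)
    ... | inj₁ y<x = inj₁ y<x
    ... | inj₂ y≡x = inj₂ (y≡x , no-descent (λ d → ℕₚ.<-irrefl y≡x (<ᵇ⇒< y x (to (T-implies {dc}) strict d))))

    from′ : Step ((a , e) , x) ((b , e′) , y) → T (y ≤ᵇ x) × T (if dc then y <ᵇ x else true)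
    from′ (inj₁ y<x) = ≤⇒≤ᵇ (ℕₚ.<⇒≤ y<x) , from (T-implies {dc}) (λ _ → <⇒<ᵇ y<x)
    from′ (inj₂ (y≡x , r)) = ≤⇒≤ᵇ (ℕₚ.≤-reflexive y≡x) , from (T-implies {dc}) (λ d → ⊥-elim (no-descent⁻ r d))
      where
      no-descent⁻ : a ≤ b ⊎ T (isZeroC e) × a ≡ suc b → ¬ T dc
      no-descent⁻ r d with b<a , q ← to (T-∧ {b <ᵇ a}) d with r
      ... | inj₁ a≤b = ℕₚ.<⇒≱ (<ᵇ⇒< b a b<a) a≤b
      ... | inj₂ (z , refl) with to (T-∨ {not (isZeroC e)}) q
      ...   | inj₁ nz = T-not⁻ nz z
      ...   | inj₂ b+2≤ = ℕₚ.<-irrefl refl (subst (_≤ suc b) (ℕₚ.+-comm b 2) (≤ᵇ⇒≤ (b + 2) (suc b) b+2≤))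

  -- `fillOK` looks positions up in the whole descent list. As `desList` produces them in increasing
  -- order, `pos` is found only if put there by the first pair, and later lookups never meet it; the
  -- test thus becomes one on adjacent cells.
  fillOK-desList : ∀ pos c d p → let π = map proj₁ (d ∷ p) in
    fillOK (desList 2 pos (proj₁ c ∷ π)) pos (ent c ∷ map ent (d ∷ p)) ≡
    (ent d ≤ᵇ ent c) ∧ (if descends c d then ent d <ᵇ ent c else true) ∧
      fillOK (desList 2 (suc pos) π) (suc pos) (map ent (d ∷ p))
  fillOK-desList pos c d p = collapse (descends c d)
    where
    S = desList 2 (suc pos) (map proj₁ (d ∷ p))
    is = map ent (d ∷ p)
    collapse : ∀ t →
      (ent d ≤ᵇ ent c) ∧ (if pos ∈ᵇ (if t then pos ∷ S else S) then ent d <ᵇ ent c else true) ∧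
        fillOK (if t then pos ∷ S else S) (suc pos) is ≡
      (ent d ≤ᵇ ent c) ∧ (if t then ent d <ᵇ ent c else true) ∧ fillOK S (suc pos) is
    collapse false rewrite ∉-desList 2 (suc pos) (map proj₁ (d ∷ p)) (ℕₚ.n<1+n pos) = refl
    collapse true  rewrite to T-≡ (≡⇒≡ᵇ pos pos refl) | fillOK-∷ S (suc pos) (ℕₚ.n<1+n pos) is = refl

  fillOK⇒good : ∀ pos p → T (fillOK (desList 2 pos (map proj₁ p)) pos (map ent p)) → Good p
  fillOK⇒good pos []              _ = []
  fillOK⇒good pos (_ ∷ [])        _ = [-]
  fillOK⇒good pos (c ∷ p@(d ∷ p′)) t =
    let t₁ , t′ = to (T-∧ {ent d ≤ᵇ ent c}) (subst T (fillOK-desList pos c d p′) t)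
        t₂ , t₃ = to (T-∧ {if descends c d then ent d <ᵇ ent c else true}) t′
    in to (step⇔ {d} {c}) (t₁ , t₂) ∷ fillOK⇒good (suc pos) p t₃

  good⇒fillOK : ∀ pos p → Good p → T (fillOK (desList 2 pos (map proj₁ p)) pos (map ent p))
  good⇒fillOK pos []              _ = tt
  good⇒fillOK pos (_ ∷ [])        _ = tt
  good⇒fillOK pos (c ∷ p@(d ∷ p′)) (s ∷ g) =
    let t₁ , t₂ = from (step⇔ {d} {c}) s
    in subst T (sym (fillOK-desList pos c d p′))
         (from (T-∧ {ent d ≤ᵇ ent c}) (t₁ , from (T-∧ {if descends c d then ent d <ᵇ ent c else true}) (t₂ , good⇒fillOK (suc pos) p g)))

  -- Enumeration and the two bijections

  isBanner : List (Letter l) → Bool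
  isBanner []            = true
  isBanner (x ∷ [])      = not (isBar x)
  isBanner (x ∷ w@(y ∷ _)) = pairOK (x , y) ∧ isBanner w

  isBanner⇒banner : ∀ w → T (isBanner w) → Banner w
  isBanner⇒banner []              _ = []
  isBanner⇒banner (x ∷ [])        t = [-] (T-not⁻ t)
  isBanner⇒banner (x ∷ w@(y ∷ _)) t =
    let p , q = to (T-∧ {pairOK (x , y)}) t in to pairOK⇔ p ∷ isBanner⇒banner w q

  banner⇒isBanner : Banner w → T (isBanner w)
  banner⇒isBanner []       = tt
  banner⇒isBanner ([-] ¬b) = T-not⁺ ¬b
  banner⇒isBanner (p ∷ b)  = from T-∧ (from pairOK⇔ p , banner⇒isBanner b)

  -- The constructors take the absolute value minus one. At `u = 0` letters of absolute value one
  -- are listed; this is harmless, since the list has only to be complete and is filtered later.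
  letters : ℕ → List (Letter l)
  letters u = bar (u ∸ 1) ∷ map (clr (u ∸ 1)) (allFin l)

  ∈-letters : ∀ x → x ∈ letters (absL x)
  ∈-letters (bar v)   = here refl
  ∈-letters (clr v m) = there (∈-map⁺ (clr v) (∈-allFin m))

  letters-complete : ∀ {c} w → map absL w ↭ c → All (_∈ concatMap letters c) w
  letters-complete {c} w w↭c = All.tabulate λ {x} x∈w →
    ∈-concatMap⁺ letters (lose (Permₚ.∈-resp-↭ w↭c (∈-map⁺ absL x∈w)) (∈-letters x))

  module Bijections (n k : ℕ) (β : Vec ℕ (l ∸ 1)) (content : List ℕ) where

    -- The Boolean form is decidable and has equal proofs, as enumeration requires; the proofs in
    -- `Banner` contain functions and would need extensionality.
    IsBannerOf : List (Letter l) → Set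
    IsBannerOf w = T (isBanner w) × length w ≡ n × cntBy isBar w ≡ k × colVecL w ≡ β ×
                   T (sameMultiset (map absL w) content)

    Banners : Set
    Banners = Σ (List (Letter l)) IsBannerOf

    isBannerOf-irrelevant : ∀ w → (p q : IsBannerOf w) → p ≡ q
    isBannerOf-irrelevant w = ×-irrelevant T-irrelevant (×-irrelevant uip
      (×-irrelevant uip (×-irrelevant uip T-irrelevant)))

    banners-finite : ∃ λ N → Banners ↔ Fin N
    banners-finite = enumerated⇒finite
      (Listₚ.≡-dec (IsStrictTotalOrder._≟_ <ᴸ-isStrictTotalOrder))
      (λ w → T? _ ×-dec (length w ℕₚ.≟ n) ×-dec (cntBy isBar w ℕₚ.≟ k) ×-dec (Vecₚ.≡-dec ℕₚ._≟_ (colVecL w) β) ×-dec T? _)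
      (λ {w} → isBannerOf-irrelevant w)
      (words n (concatMap letters content))
      (λ {w} (_ , |w|≡n , _ , _ , same) → subst (λ m → w ∈ words m _) |w|≡n
        (∈-words w (letters-complete w (sameMultiset⇒↭ (map absL w) content same))))

    banners-≡ : ∀ {a b : Banners} → proj₁ a ≡ proj₁ b → a ≡ b
    banners-≡ {w , p} {_ , q} refl = cong (w ,_) (isBannerOf-irrelevant w p q)

    Ornaments : Set
    Ornaments = Fiber (QObj l n k β) qWt content

    ornaments-≡ : ∀ {a b : Ornaments} → proj₁ (proj₁ a) ≡ proj₁ (proj₁ b) → a ≡ b
    ornaments-≡ {(o , p) , s} {(_ , q) , t} refl = cong₂ (λ p s → (o , p) , s)
      (×-irrelevant T-irrelevant (×-irrelevant uip (×-irrelevant uip uip)) p q) (T-irrelevant s t)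

    ornaments↔banners : Ornaments ↔ Banners
    ornaments↔banners = bifunctional⇒↔ (λ a b → Factors (proj₁ (proj₁ a)) (proj₁ b))
      toBanner toOrnament
      (λ f f′ → banners-≡ (factors-functional f f′))
      (λ {a} {a′} f f′ → ornaments-≡ (factors-injective (orn a) (orn a′) f f′))
      where
      orn : (a : Ornaments) → IsOrnament (proj₁ (proj₁ a))
      orn ((o , t , _) , _) = to ornament⇔ t

      toBanner : ∀ a → ∃ λ (b : Banners) → Factors (proj₁ (proj₁ a)) (proj₁ b)
      toBanner a@((o , t , |o|≡n , bars , cols) , same)
        with w , ban , fac ← ornament⇒banner (orn a) = let o↭w = factors-↭ fac in
        (w , banner⇒isBanner ban
           , trans (sym (Permₚ.↭-length o↭w)) |o|≡n
           , trans (sym (cntBy-↭ isBar o↭w)) bars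
           , trans (sym (tabulate-cong λ j → cntBy-↭ _ o↭w)) cols
           , ↭⇒sameMultiset (↭-trans (Permₚ.map⁺ absL (↭-sym o↭w)) (sameMultiset⇒↭ _ _ same)))
        , fac

      toOrnament : ∀ (b : Banners) → ∃ λ (a : Ornaments) → Factors (proj₁ (proj₁ a)) (proj₁ b)
      toOrnament (w , ban , |w|≡n , bars , cols , same)
        with o , orn , fac ← banner⇒ornament (isBanner⇒banner w ban) = let o↭w = factors-↭ fac in
        ((o , from ornament⇔ orn
            , trans (Permₚ.↭-length o↭w) |w|≡n
            , trans (cntBy-↭ isBar o↭w) bars
            , trans (tabulate-cong λ j → cntBy-↭ _ o↭w) cols)
          , ↭⇒sameMultiset (↭-trans (Permₚ.map⁺ absL o↭w) (sameMultiset⇒↭ _ _ same)))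
        , fac

    Fillings : Set
    Fillings = Fiber (RHSObj l n k β) rhsWt content

    π-of : Fillings → CWord l
    π-of ((π , _) , _) = π

    i-of : Fillings → List ℕ
    i-of ((_ , _ , _ , _ , (i , _)) , _) = i

    fillings-≡ : ∀ {a b} → π-of a ≡ π-of b → i-of a ≡ i-of b → a ≡ b
    fillings-≡ {(π , t , q , r , (i , u)) , s} {(_ , t′ , q′ , r′ , (_ , u′)) , s′} refl refl
      rewrite T-irrelevant t t′ | uip q q′ | uip r r′ | T-irrelevant u u′ | T-irrelevant s s′ = refl

    fillings↔banners : 1 ≤ l → Fillings ↔ Banners
    fillings↔banners 1≤l = bifunctional⇒↔ Reads toBanner toFilling
      (λ (p , π≡ , i≡ , enc , _) (p′ , π≡′ , i≡′ , enc′ , _) → banners-≡ (encodes-functional _ _ enc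
        (subst (λ p → Encodes p _) (sym (map-proj-injective (trans (sym π≡) π≡′) (trans (sym i≡) i≡′))) enc′)))
      (λ (p , π≡ , i≡ , enc , g) (p′ , π≡′ , i≡′ , enc′ , g′) →
        let p≡p′ = encodes-injective _ enc enc′ g g′ in fillings-≡
          (trans π≡ (trans (cong (map proj₁) p≡p′) (sym π≡′)))
          (trans i≡ (trans (cong (map proj₂) p≡p′) (sym i≡′))))
      where
      Reads : Fillings → Banners → Set
      Reads a b = ∃ λ p → π-of a ≡ map proj₁ p × i-of a ≡ map ent p × Encodes p (proj₁ b) × Good p

      colPerm-length : ∀ {π : CWord l} → map proj₁ π ↭ applyUpTo suc n → length π ≡ n
      colPerm-length {π} vals = trans (sym (length-map proj₁ π))
        (trans (Permₚ.↭-length vals) (length-applyUpTo suc n))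

      toBanner : ∀ a → ∃ (Reads a)
      toBanner ((π , perm , inv , cols , (i , fill)) , same)
        with |i|≡n , fill′ ← to (T-∧ {length i ≡ᵇ n}) fill
        with positive , ok ← to (T-∧ {all (1 ≤ᵇ_) i}) fill′
        with vals ← sameMultiset⇒↭ (map proj₁ π) (applyUpTo suc n) perm
        with p , refl , refl ← unzip-≡ π i (trans (colPerm-length vals) (sym (≡ᵇ⇒≡ (length i) n |i|≡n)))
        with w , |w|≡n , enc ← encode n p (subst (_↭ _) (sym (map-∘ p)) vals)
               (Allₚ.map⁻ (All.map (≤ᵇ⇒≤ 1 _) (Allₚ.all⁺ _ _ positive)))
        = (w , banner⇒isBanner (good⇒banner w enc (fillOK⇒good 1 p ok))
             , |w|≡n
             , trans (sym (encodes-inv w enc)) inv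
             , trans (sym (encodes-colVec w enc)) cols
             , ↭⇒sameMultiset (↭-trans (↭-sym (encodes-ents w enc)) (sameMultiset⇒↭ _ _ same)))
        , p , refl , refl , enc , fillOK⇒good 1 p ok

      toFilling : ∀ b → ∃ λ a → Reads a b
      toFilling (w , ban , |w|≡n , bars , cols , same)
        with p , enc , g ← decode 1≤l w (isBanner⇒banner w ban)
        = ((map proj₁ p
             , ↭⇒sameMultiset (subst₂ (λ u m → u ↭ applyUpTo suc m) (map-∘ p) |w|≡n (encodes-vals w enc))
             , trans (encodes-inv w enc) bars
             , trans (encodes-colVec w enc) cols
             , (map ent p , from T-∧
                 ( ≡⇒≡ᵇ _ _ (trans (length-map ent p) (trans (encodes-length w enc) |w|≡n))
                 , from T-∧
                   ( Allₚ.all⁻ _ (Permₚ.All-resp-↭ (↭-sym (encodes-ents w enc))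
                       (Allₚ.map⁺ (All.universal absL-positive w)))
                   , good⇒fillOK 1 p g))))
          , ↭⇒sameMultiset (↭-trans (encodes-ents w enc) (sameMultiset⇒↭ _ _ same)))
        , p , refl , refl , enc , g
        where
        absL-positive : ∀ x → T (1 ≤ᵇ absL x)
        absL-positive (clr _ _) = tt
        absL-positive (bar _)   = tt

theorem5p1 : (l : ℕ) → 1 ≤ l → (n k : ℕ) → 1 ≤ n → (β : Vec ℕ (l ∸ 1)) →
    SameGF (QObj l n k β) qWt (RHSObj l n k β) rhsWt
theorem5p1 l 1≤l n k _ β content =
  let N , banners↔Fin = banners-finite in
  N , banners↔Fin ↔-∘ ornaments↔banners , banners↔Fin ↔-∘ fillings↔banners 1≤l
  where open Bijections {l} n k β content
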